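{- Let $n$ and $r$ be nonnegative integers, and let $G$ be an $(n+r+2)$-connected graph. If the isolated toughness of $G$ satisfies $I(G)>\frac{n+3(r+2)}{2(r+2)}$, then $G$ is $(P_{\geq3},n)$-factor critical avoidable; that is, for every $W\subseteq V(G)$ with $|W|=n$ and every edge $e\in E(G-W)$, the graph $G-W-e$ has a $P_{\geq 3}$-factor.
   Context: All graphs are finite, undirected and simple. For $X\subseteq V(G)$, $G-X$ deletes the vertices of $X$; $G-e$ deletes edge $e$. $i(G)$ denotes the number of isolated vertices of $G$. The isolated toughness of $G$ is $I(G)=+\infty$ if $G$ is complete, and otherwise $I(G)=\min\{|X|/i(G-X): X\subseteq V(G),\ i(G-X)\geq 2\}$. A path factor of $G$ is a spanning subgraph every component of which is a path of order at least 2; for an integer $k\geq2$, a $P_{\geq k}$-factor is a path factor each of whose components has at least $k$ vertices. $G$ is $P_{\geq k}$-factor avoidable if for every $e\in E(G)$, $G$ has a $P_{\geq k}$-factor not containing $e$. $G$ is $(P_{\geq k},n)$-factor critical avoidable if for every $W\subseteq V(G)$ with $|W|=n$, $G-W$ is $P_{\geq k}$-factor avoidable. -}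

module Defs where

open import Data.Nat using (ℕ; _≤_; _<_; _*_; _+_)
open import Data.Bool using (Bool; true; false; not; _∧_; _∨_)
open import Data.Fin using (Fin)
open import Data.Fin.Subset using (Subset; _∈_; _∉_; ∣_∣; ∁)
open import Data.Vec using (lookup; tabulate)
open import Data.List using (List; []; _∷_; length; concat; allFin)
open import Data.List.Relation.Unary.All using (All)
open import Data.List.Relation.Unary.Unique.Propositional using (Unique)
import Data.List.Membership.Propositional as LM
open import Data.Product using (_×_)
open import Relation.Binary.PropositionalEquality using (_≡_)
open import Relation.Nullary using (¬_)
open import Function.Bundles using (_⇔_)

allB : {A : Set} → (A → Bool) → List A → Bool
allB p [] = true
allB p (x ∷ xs) = p x ∧ allB p xs

record Graph (N : ℕ) : Set where
  field
    adj   : Fin N → Fin N → Bool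
    sym   : ∀ u v → adj u v ≡ adj v u
    irrfl : ∀ v → adj v v ≡ false
open Graph public

module _ {N : ℕ} (G : Graph N) where

  data Reach (S : Subset N) : Fin N → Fin N → Set where
    here : ∀ {x} → x ∈ S → Reach S x x
    step : ∀ {x y z} → x ∈ S → adj G x y ≡ true → Reach S y z → Reach S x z

  ConnectedOn : Subset N → Set
  ConnectedOn S = ∀ x y → x ∈ S → y ∈ S → Reach S x y

  KConnected : ℕ → Set
  KConnected k = (k < N) × (∀ (X : Subset N) → ∣ X ∣ < k → ConnectedOn (∁ X))

  isolatedSet : Subset N → Subset N
  isolatedSet X = tabulate (λ v → not (lookup X v) ∧
                     allB (λ u → not (adj G u v) ∨ lookup X u) (allFin N))

  iso : Subset N → ℕ
  iso X = ∣ isolatedSet X ∣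

  -- I(G) > a / b  (b > 0), unfolding the definition of isolated toughness:
  -- if G is complete, I(G) = +∞ and no X has i(G-X) ≥ 2; otherwise I(G) is the
  -- minimum of |X| / i(G-X) over X with i(G-X) ≥ 2, and min > a/b means every
  -- such ratio exceeds a/b, i.e. a * i(G-X) < b * |X|.
  IsolatedToughnessGt : ℕ → ℕ → Set
  IsolatedToughnessGt a b = ∀ (X : Subset N) → 2 ≤ iso X → a * iso X < b * ∣ X ∣

  data IsPath (ok : Fin N → Fin N → Set) : List (Fin N) → Set where
    nil  : IsPath ok []
    one  : ∀ x → IsPath ok (x ∷ [])
    cons : ∀ {x y xs} → ok x y → IsPath ok (y ∷ xs) → IsPath ok (x ∷ y ∷ xs)

  EdgeAvoiding : Fin N → Fin N → Fin N → Fin N → Set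
  EdgeAvoiding a b x y = (adj G x y ≡ true) × ¬ (x ≡ a × y ≡ b) × ¬ (x ≡ b × y ≡ a)

  -- A P≥k-factor of G[S] - ab: a spanning subgraph of G[S] - ab each of
  -- whose components is a path of order ≥ k, given as the list of its
  -- component paths (vertex-disjoint, covering exactly S).
  record PathFactorAvoiding (k : ℕ) (S : Subset N) (a b : Fin N) : Set where
    field
      paths  : List (List (Fin N))
      long   : All (λ p → k ≤ length p) paths
      valid  : All (IsPath (EdgeAvoiding a b)) paths
      disj   : Unique (concat paths)
      cover  : ∀ v → (v ∈ S) ⇔ (v LM.∈ concat paths)

{-# OPTIONS --safe #-}

-- Cover G - W - e by disjoint paths, calling those with one or two vertices (the pieces) bad. From
-- a bad piece grow an alternating tree: an outside neighbour of a tree piece lies inside a long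
-- path and cuts it into two halves of at most two vertices each (otherwise the number of bad paths
-- drops), so it joins the tree as a centre with the two halves as new pieces. Any piece can be
-- made the root, and everything below the root is covered by the paths "left half - centre - right
-- half". When the tree cannot grow, either its vertex set splits into long paths, or single pieces
-- are adjacent to centres only and each pair has an end (its leaf) with no neighbour in other
-- pieces. Deleting the m centres and the other ends of the pairs then isolates 2m + 1 vertices.
-- For m ≥ r + 2 this violates the toughness bound, even if e joins two of these vertices, since a
-- single piece costs no deletion besides the centres. For m ≤ r + 1 it contradicts connectivity:
-- if m ≥ 1, one of the at least three pieces avoids e, and m = 0 would give a vertex of degree at
-- most one.
module Submission where

open import Defs hiding (sym)
open import Data.Bool using (Bool; true; false; not; _∧_; _∨_)
import Data.Bool as Bool
open import Data.Empty using (⊥; ⊥-elim)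
open import Data.Fin using (Fin; _≟_)
open import Data.Fin.Subset using (Subset; ∣_∣; ∁; _∪_; ⁅_⁆; inside; outside; _-_) renaming (_∈_ to _∈ˢ_; _∉_ to _∉ˢ_)
open import Data.Fin.Subset.Properties using (x∈p∪q⁺; x∈p∪q⁻; x∈⁅x⁆; x∈⁅y⁆⇒x≡y; ∣⁅x⁆∣≡1; x∈p⇒∣p-x∣<∣p∣; x∈p∧x≢y⇒x∈p-y; nonempty?; Empty-unique; ∣⊥∣≡0; ∣∁p∣≡n∸∣p∣; x∈∁p⇒x∉p; x∉p⇒x∈∁p) renaming (_∈?_ to _∈ˢ?_)
open import Data.List using (List; []; _∷_; [_]; _++_; _ʳ++_; length; concat; concatMap; map; filter; allFin)
open import Data.List.Properties using (length-ʳ++; length-map; length-++; concatMap-++; concat-++; ++-identityʳ; ++-assoc; map-id)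
open import Data.List.Membership.Propositional using (_∈_; _∉_; find; lose)
open import Data.List.Membership.Propositional.Properties using (∈-++⁺ˡ; ∈-++⁺ʳ; ∈-++⁻; ∈-∃++; ∈-concat⁻′; ∈-concatMap⁺; ∈-concatMap⁻; ∈-map⁺; ∈-map⁻; ∈-filter⁺; ∈-filter⁻; ∈-allFin)
open import Data.List.Relation.Binary.Disjoint.Propositional using (Disjoint)
open import Data.List.Relation.Binary.Permutation.Propositional as Perm using (_↭_; ↭-refl; ↭-sym; ↭-trans; ↭-reflexive; prep; swap; ↭⇒↭ₛ)
open import Data.List.Relation.Binary.Permutation.Propositional.Properties using (++⁺; ++⁺ˡ; ++⁺ʳ; ++↭ʳ++; ++-comm; ++-commutativeMonoid; ∈-resp-↭; drop-∷; shift; All-resp-↭; ↭-length)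
open import Data.List.Relation.Binary.Permutation.Setoid.Properties using (Unique-resp-↭)
open import Data.List.Relation.Unary.All as All using (All; []; _∷_)
import Data.List.Relation.Unary.All.Properties as All
open import Data.List.Relation.Unary.AllPairs using ([]; _∷_)
open import Data.List.Relation.Unary.Any using (Any; here; there; any?)
open import Data.List.Relation.Unary.Unique.Propositional using (Unique)
open import Data.List.Relation.Unary.Unique.Propositional.Properties using (filter⁺; allFin⁺)
open import Data.Nat using (ℕ; zero; suc; _+_; _*_; _∸_; _≤_; _<_; z≤n; s≤s; s≤s⁻¹; _≤?_)
open import Data.Nat.Properties using (*-monoʳ-≤; *-monoˡ-≤; +-assoc; +-identityʳ; +-mono-≤; +-monoʳ-≤; +-monoˡ-≤; +-suc; <-≤-trans; <⇒≱; m∸n≡0⇒m≤n; m≤m+n; m≤n+m; n≤1+n; suc-injective; ≤-<-trans; ≤-refl; ≤-reflexive; ≤-trans; ≰⇒>; module ≤-Reasoning)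
open import Data.Nat.Tactic.RingSolver using (solve-∀)
open import Data.Product using (∃; _×_; _,_; proj₁; proj₂; map₂) renaming (swap to ×-swap)
open import Data.Sum using (_⊎_; inj₁; inj₂; [_,_]′) renaming (map₂ to ⊎-map₂; swap to ⊎-swap)
open import Data.Vec using (lookup; []; _∷_)
open import Data.Vec.Properties using (lookup⇒[]=; []=⇒lookup; lookup∘tabulate)
open import Function using (_∘_; mk⇔)
open import Relation.Binary.PropositionalEquality using (_≡_; _≢_; refl; sym; trans; cong; cong₂; subst; subst₂; setoid)
open import Relation.Nullary using (¬_; Dec; yes; no; ¬?; _×-dec_; _⊎-dec_; contradiction)
import Algebra.Solver.CommutativeMonoid as CMSolver

-- Lists up to permutation.

open module ListSolver {A : Set} = CMSolver (++-commutativeMonoid {A = A}) using (solve; _⊜_; _⊕_) renaming (id to nil′)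

concatMap-↭ : ∀ {A B : Set} (f : A → List B) {xs ys} → xs ↭ ys → concatMap f xs ↭ concatMap f ys
concatMap-↭ f Perm.refl = ↭-refl
concatMap-↭ f (prep x p) = ++⁺ˡ (f x) (concatMap-↭ f p)
concatMap-↭ f (swap {xs} {ys} x y p) = ↭-trans
  (++⁺ˡ (f x) (++⁺ˡ (f y) (concatMap-↭ f p)))
  (solve 3 (λ a b c → a ⊕ b ⊕ c ⊜ b ⊕ a ⊕ c) ↭-refl (f x) (f y) (concatMap f ys))
concatMap-↭ f (Perm.trans p q) = ↭-trans (concatMap-↭ f p) (concatMap-↭ f q)

∈⇒↭ : ∀ {A : Set} {x : A} {xs} → x ∈ xs → ∃ λ ys → xs ↭ x ∷ ys
∈⇒↭ {x = x} x∈ with ∈-∃++ x∈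
... | ys , zs , refl = ys ++ zs , shift x ys zs

∈⇒ʳ++ : ∀ {A : Set} {x : A} {xs} → x ∈ xs → ∃ λ ls → ∃ λ rs → xs ≡ ls ʳ++ (x ∷ rs)
∈⇒ʳ++ = go []
  where
  go : ∀ {A : Set} {x : A} {xs} ls → x ∈ xs → ∃ λ ls′ → ∃ λ rs → ls ʳ++ xs ≡ ls′ ʳ++ (x ∷ rs)
  go ls (here refl) = ls , _ , refl
  go ls (there {y} x∈) = go (y ∷ ls) x∈

-- Alternating trees of short paths

module PathPacking {N : ℕ} (G : Graph N) (E : Fin N → Fin N → Set)
                   (E-sym : ∀ {x y} → E x y → E y x) where

  V : Set
  V = Fin N

  Path : List V → Set
  Path = IsPath G E

  path-tail : ∀ {x xs} → Path (x ∷ xs) → Path xs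
  path-tail (one x) = nil
  path-tail (cons _ p) = p

  path-ʳ++ : ∀ {x} xs {y ys} → Path (x ∷ xs) → E x y → Path (y ∷ ys) → Path ((x ∷ xs) ʳ++ (y ∷ ys))
  path-ʳ++ []       p            e q = cons e q
  path-ʳ++ (_ ∷ xs) (cons e′ p) e q = path-ʳ++ xs p (E-sym e′) (cons e q)

  path-split : ∀ xs {y ys} → Path (xs ʳ++ (y ∷ ys)) → Path (y ∷ xs) × Path (y ∷ ys)
  path-split []       p = one _ , p
  path-split (x ∷ xs) p with path-split xs p
  ... | q , cons e r = cons (E-sym e) q , r

  -- A single permutation encodes coverage, and also disjointness once `vs` has no repetitions.
  record Good (vs : List V) : Set where
    constructor good
    field
      paths : List (List V)
      long  : All (λ p → 3 ≤ length p) paths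
      valid : All Path paths
      perm  : concat paths ↭ vs

  good-[] : Good []
  good-[] = good [] [] [] ↭-refl

  good-↭ : ∀ {xs ys} → xs ↭ ys → Good xs → Good ys
  good-↭ p (good ps l v q) = good ps l v (↭-trans q p)

  good-++ : ∀ {xs ys} → Good xs → Good ys → Good (xs ++ ys)
  good-++ (good ps l v p) (good qs l′ v′ q) = good (ps ++ qs) (All.++⁺ l l′) (All.++⁺ v v′)
    (↭-trans (↭-reflexive (sym (concat-++ ps qs))) (++⁺ p q))

  good-path : ∀ {p} → 3 ≤ length p → Path p → Good p
  good-path {p} l v = good (p ∷ []) (l ∷ []) (v ∷ []) (↭-reflexive (++-identityʳ p))

  good-bent : ∀ {x xs y ys} → Path (x ∷ xs) → E x y → Path (y ∷ ys) → 3 ≤ length (x ∷ xs) + length (y ∷ ys) →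
              Good ((x ∷ xs) ++ (y ∷ ys))
  good-bent {x} {xs} {y} {ys} p e q l = good-↭ (↭-sym (++↭ʳ++ (x ∷ xs) (y ∷ ys)))
    (good-path (subst (3 ≤_) (sym (length-ʳ++ (x ∷ xs))) l) (path-ʳ++ xs p e q))

  data Piece : Set where
    K1 : V → Piece
    K2 : (x y : V) → E x y → Piece

  verts : Piece → List V
  verts (K1 x)     = x ∷ []
  verts (K2 x y _) = x ∷ y ∷ []

  vertsOf : List Piece → List V
  vertsOf = concatMap verts

  -- A path on at most two vertices can be read from either end, so every vertex of a piece can
  -- serve as the end at which it is attached.
  arm : ∀ B {x} → x ∈ verts B → ∃ λ xs → Path (x ∷ xs) × (x ∷ xs ↭ verts B)
  arm (K1 x)     (here refl)         = [] , one x , ↭-refl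
  arm (K2 x y e) (here refl)         = y ∷ [] , cons e (one y) , ↭-refl
  arm (K2 x y e) (there (here refl)) = x ∷ [] , cons (E-sym e) (one x) , swap y x ↭-refl

  record Link (w : V) (B : Piece) : Set where
    constructor link
    field
      {end} : V
      end∈  : end ∈ verts B
      edge  : E end w
  open Link

  -- A tree is a list of branches at its root piece `B`: `branch` puts a centre `w` with two child
  -- pieces and their subtrees in front of the remaining branches at `B`.
  data Tree (B : Piece) : Set where
    leaf   : Tree B
    branch : ∀ w {L R} → Link w B → Link w L → Link w R → Tree L → Tree R → Tree B → Tree B

  pieces : ∀ {B} → Tree B → List Piece
  pieces leaf = []
  pieces (branch w {L} {R} _ _ _ tl tr t) = (L ∷ pieces tl) ++ (R ∷ pieces tr) ++ pieces t

  centers : ∀ {B} → Tree B → List V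
  centers leaf = []
  centers (branch w _ _ _ tl tr t) = w ∷ centers tl ++ centers tr ++ centers t

  below : ∀ {B} → Tree B → List V
  below t = centers t ++ vertsOf (pieces t)

  whole : ∀ {B} → Tree B → List V
  whole {B} t = verts B ++ below t

  vertsOf-++ : ∀ ps qs → vertsOf (ps ++ qs) ≡ vertsOf ps ++ vertsOf qs
  vertsOf-++ = concatMap-++ verts

  below-branch : ∀ {B} w {L R} (b : Link w B) (l : Link w L) (r : Link w R) tl tr t →
                 below (branch w b l r tl tr t) ↭ (w ∷ []) ++ whole tl ++ whole tr ++ below t
  below-branch w {L} {R} b l r tl tr t
    rewrite vertsOf-++ (L ∷ pieces tl) ((R ∷ pieces tr) ++ pieces t)
          | vertsOf-++ (R ∷ pieces tr) (pieces t) =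
    solve 9 (λ w cl cr ct L R pl pr pt →
        (w ⊕ cl ⊕ cr ⊕ ct) ⊕ (L ⊕ pl) ⊕ (R ⊕ pr) ⊕ pt ⊜ w ⊕ (L ⊕ cl ⊕ pl) ⊕ (R ⊕ cr ⊕ pr) ⊕ ct ⊕ pt)
      ↭-refl (w ∷ []) (centers tl) (centers tr) (centers t) (verts L) (verts R)
      (vertsOf (pieces tl)) (vertsOf (pieces tr)) (vertsOf (pieces t))

  -- The path runs through an arm of R, then w, then mid, then an arm of T.
  splice : ∀ w {R T x} (mid : List V) → Link w R → x ∈ verts T →
           (∀ {xs} → Path (x ∷ xs) → Path (w ∷ mid ++ x ∷ xs)) →
           Good ((w ∷ []) ++ mid ++ verts R ++ verts T)
  splice w {R} {T} {x} mid (link r∈ e) x∈ ext with arm R r∈ | arm T x∈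
  ... | rs , pr , permR | xs , px , permT = good-↭
    (↭-trans (++⁺ permR ↭-refl)
      (↭-trans (++⁺ˡ (verts R) (++⁺ˡ (w ∷ mid) permT))
        (solve 4 (λ a b c d → c ⊕ (a ⊕ b) ⊕ d ⊜ a ⊕ b ⊕ c ⊕ d) ↭-refl (w ∷ []) mid (verts R) (verts T))))
    (good-bent pr e (ext px) (s≤s (≤-trans (s≤s (len mid)) (m≤n+m (length (w ∷ mid ++ x ∷ xs)) (length rs)))))
    where
    len : ∀ ms → 1 ≤ length (ms ++ x ∷ xs)
    len []       = s≤s z≤n
    len (_ ∷ ms) = s≤s z≤n

  -- Each centre is covered together with its own two children, so only the root piece is left out.
  default : ∀ {B} (t : Tree B) → Good (below t)
  default leaf = good-[]
  default (branch w {L} {R} b l r tl tr t) = good-↭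
    (↭-trans
      (solve 6 (λ w L R a b c → (w ⊕ R ⊕ L) ⊕ a ⊕ b ⊕ c ⊜ w ⊕ (L ⊕ a) ⊕ (R ⊕ b) ⊕ c) ↭-refl
        (w ∷ []) (verts L) (verts R) (below tl) (below tr) (below t))
      (↭-sym (below-branch w b l r tl tr t)))
    (good-++ (splice w [] r (end∈ l) (cons (E-sym (edge l))))
      (good-++ (default tl) (good-++ (default tr) (default t))))

  -- Rerooting.

  graft : ∀ {B} → Tree B → Tree B → Tree B
  graft leaf u = u
  graft (branch w b l r tl tr t) u = branch w b l r tl tr (graft t u)

  graft-leaf : ∀ {B} (u : Tree B) → u ≡ graft u leaf
  graft-leaf leaf = refl
  graft-leaf (branch w b l r tl tr t) = cong (branch w b l r tl tr) (graft-leaf t)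

  -- The shape is forgotten: coverings depend only on the multisets of pieces and centres.
  record _≈_ {B Q} (t : Tree Q) (u : Tree B) : Set where
    constructor same
    field
      pieces-↭  : Q ∷ pieces t ↭ B ∷ pieces u
      centers-↭ : centers t ↭ centers u

  ≈-refl : ∀ {B} {t : Tree B} → t ≈ t
  ≈-refl = same ↭-refl ↭-refl

  ≈-sym : ∀ {B Q} {t : Tree B} {u : Tree Q} → t ≈ u → u ≈ t
  ≈-sym (same p c) = same (↭-sym p) (↭-sym c)

  ≈-trans : ∀ {B C D} {t : Tree B} {u : Tree C} {v : Tree D} → t ≈ u → u ≈ v → t ≈ v
  ≈-trans (same p c) (same q d) = same (↭-trans p q) (↭-trans c d)

  whole-≈ : ∀ {B Q} {t : Tree B} {u : Tree Q} → t ≈ u → whole t ↭ whole u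
  whole-≈ {B} {Q} {t} {u} (same p c) =
    ↭-trans (regroup B t) (↭-trans (++⁺ c (concatMap-↭ verts p)) (↭-sym (regroup Q u)))
    where
    regroup : ∀ B (t : Tree B) → whole t ↭ centers t ++ vertsOf (B ∷ pieces t)
    regroup B t = solve 3 (λ a b c → a ⊕ b ⊕ c ⊜ b ⊕ a ⊕ c) ↭-refl (verts B) (centers t) (vertsOf (pieces t))

  graft-≈ : ∀ {B} w {L R} (b : Link w B) (l : Link w L) (r : Link w R) tl tr t u →
            graft (branch w b l r tl tr t) u ≈ graft t (branch w b l r tl tr u)
  graft-≈ w {L} {R} b l r tl tr leaf u = ≈-refl
  graft-≈ {B} w {L} {R} b l r tl tr (branch w′ {L′} {R′} b′ l′ r′ tl′ tr′ t) u
    with graft-≈ w b l r tl tr t u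
  ... | same p c = same
    (↭-trans (solve 6 (λ B L R L′ R′ g → B ⊕ L ⊕ R ⊕ L′ ⊕ R′ ⊕ g ⊜ L′ ⊕ R′ ⊕ B ⊕ L ⊕ R ⊕ g) ↭-refl
        [ B ] (L ∷ pieces tl) (R ∷ pieces tr) (L′ ∷ pieces tl′) (R′ ∷ pieces tr′) (pieces (graft t u)))
      (↭-trans (++⁺ˡ (L′ ∷ pieces tl′) (++⁺ˡ (R′ ∷ pieces tr′) p))
        (solve 4 (λ B L′ R′ g → L′ ⊕ R′ ⊕ B ⊕ g ⊜ B ⊕ L′ ⊕ R′ ⊕ g) ↭-refl
          [ B ] (L′ ∷ pieces tl′) (R′ ∷ pieces tr′) (pieces (graft t (branch w b l r tl tr u))))))
    (↭-trans (solve 7 (λ w w′ a b c d g → (w ⊕ a ⊕ b ⊕ w′ ⊕ c ⊕ d ⊕ g) ⊜ (w′ ⊕ c ⊕ d ⊕ w ⊕ a ⊕ b ⊕ g)) ↭-refl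
        [ w ] [ w′ ] (centers tl) (centers tr) (centers tl′) (centers tr′) (centers (graft t u)))
      (prep w′ (++⁺ˡ (centers tl′) (++⁺ˡ (centers tr′) c))))

  swap-≈ : ∀ {B} w {L R} (b : Link w B) (l : Link w L) (r : Link w R) tl tr t →
           branch w b l r tl tr t ≈ branch w b r l tr tl t
  swap-≈ {B} w {L} {R} b l r tl tr t = same
    (prep B (solve 3 (λ a b c → a ⊕ b ⊕ c ⊜ b ⊕ a ⊕ c) ↭-refl (L ∷ pieces tl) (R ∷ pieces tr) (pieces t)))
    (prep w (solve 3 (λ a b c → a ⊕ b ⊕ c ⊜ b ⊕ a ⊕ c) ↭-refl (centers tl) (centers tr) (centers t)))

  -- The root moves across one centre: `L` becomes the root, and `B` with its other branches `t`
  -- takes the place of `L` below `w`.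
  rotate-≈ : ∀ {B} w {L R} (b : Link w B) (l : Link w L) (r : Link w R) tl tr t →
             branch w b l r tl tr t ≈ graft tl (branch w l b r t tr leaf)
  rotate-≈ {B} w {L} {R} b l r tl tr t = ≈-trans (same
      (solve 5 (λ B L R a b → B ⊕ (L ⊕ a) ⊕ R ⊕ b ⊜ L ⊕ (B ⊕ b) ⊕ R ⊕ a) ↭-refl
        [ B ] [ L ] (R ∷ pieces tr) (pieces tl) (pieces t))
      (prep w (solve 3 (λ a b c → a ⊕ b ⊕ c ⊜ c ⊕ b ⊕ a) ↭-refl (centers tl) (centers tr) (centers t))))
    (push tl)
    where
    push : ∀ u → branch w l b r t tr u ≈ graft u (branch w l b r t tr leaf)
    push u = subst (λ u′ → branch w l b r t tr u′ ≈ graft u (branch w l b r t tr leaf)) (sym (graft-leaf u))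
      (graft-≈ w l b r t tr u leaf)

  -- The accumulator `u` holds the branches at the current root that were already passed or turned
  -- around, which keeps the descent towards `Q` structural in `t`.
  reroot-graft : ∀ {B} (t u : Tree B) {Q} → Q ∈ B ∷ pieces t → ∃ λ (t′ : Tree Q) → t′ ≈ graft t u
  reroot-graft t u (here refl) = graft t u , ≈-refl
  reroot-graft (branch w {L} {R} b l r tl tr t) u (there Q∈) with ∈-++⁻ (L ∷ pieces tl) Q∈
  ... | inj₁ Q∈L = map₂ (λ s → ≈-trans s (≈-sym (rotate-≈ w b l r tl tr (graft t u))))
          (reroot-graft tl (branch w l b r (graft t u) tr leaf) Q∈L)
  ... | inj₂ Q∈′ with ∈-++⁻ (R ∷ pieces tr) Q∈′
  ...   | inj₁ Q∈R = map₂
            (λ s → ≈-trans s (≈-trans (≈-sym (rotate-≈ w b r l tr tl (graft t u))) (swap-≈ w b r l tr tl (graft t u))))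
            (reroot-graft tr (branch w r b l (graft t u) tl leaf) Q∈R)
  ...   | inj₂ Q∈t = map₂ (λ s → ≈-trans s (≈-sym (graft-≈ w b l r tl tr t u)))
            (reroot-graft t (branch w b l r tl tr u) (there Q∈t))

  reroot : ∀ {B} (t : Tree B) {Q} → Q ∈ B ∷ pieces t → ∃ λ (t′ : Tree Q) → t′ ≈ t
  reroot t {Q} Q∈ = subst (λ u → ∃ λ (t′ : Tree Q) → t′ ≈ u) (sym (graft-leaf t)) (reroot-graft t leaf Q∈)

  -- Edges between two pieces of a tree.

  record Focus {B} (T : Piece) (t : Tree B) : Set where
    constructor focused
    field
      {w}   : V
      {L R} : Piece
      toB   : Link w B
      toL   : Link w L
      toR   : Link w R
      tl    : Tree L
      tr    : Tree R
      rest  : Tree B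
      T∈    : T ∈ L ∷ pieces tl
      view  : t ≈ branch w toB toL toR tl tr rest

  -- Branches at the root commute and the two children of a centre can be exchanged, so the branch
  -- containing `T` comes to the front with `T` on its left.
  focus : ∀ {B T} (t : Tree B) → T ∈ pieces t → Focus T t
  focus (branch w {L} {R} b l r tl tr t) T∈ with ∈-++⁻ (L ∷ pieces tl) T∈
  ... | inj₁ T∈L = focused b l r tl tr t T∈L ≈-refl
  ... | inj₂ T∈′ with ∈-++⁻ (R ∷ pieces tr) T∈′
  ...   | inj₁ T∈R = focused b r l tr tl t T∈R (swap-≈ w b l r tl tr t)
  ...   | inj₂ T∈t with focus t T∈t
  ...     | focused {w′} {L′} {R′} b′ l′ r′ tl′ tr′ rest T∈′′ (same p c) =
    focused b′ l′ r′ tl′ tr′ (branch w b l r tl tr rest) T∈′′ (≈-trans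
      (same (shuffle (L ∷ pieces tl) (R ∷ pieces tr) p) (prep w (++⁺ˡ (centers tl) (++⁺ˡ (centers tr) c))))
      (graft-≈ w b l r tl tr (branch w′ b′ l′ r′ tl′ tr′ leaf) rest))
    where
    shuffle : ∀ {B : Piece} xs ys {zs zs′} → B ∷ zs ↭ B ∷ zs′ → B ∷ xs ++ ys ++ zs ↭ B ∷ xs ++ ys ++ zs′
    shuffle {B} xs ys q = prep B (++⁺ˡ xs (++⁺ˡ ys (drop-∷ q)))

  module _ {B} {t : Tree B} {T} (f : Focus T t) where
    open Focus f

    -- Once the left subtree is rerooted at `T`, a path from `R` through `w` and `mid` into `T`
    -- covers the centre, and default paths cover the rest. The detour `mid` lets the branch absorb
    -- vertices of the root piece.
    limb : ∀ {x} mid → x ∈ verts T → (∀ {xs} → Path (x ∷ xs) → Path (w ∷ mid ++ x ∷ xs)) →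
           Good (mid ++ (w ∷ []) ++ whole tl ++ whole tr)
    limb mid x∈ ext with reroot tl T∈
    ... | tl′ , s = good-↭
      (↭-trans
        (solve 6 (λ w m R T a b → (w ⊕ m ⊕ R ⊕ T) ⊕ a ⊕ b ⊜ m ⊕ w ⊕ (T ⊕ a) ⊕ (R ⊕ b)) ↭-refl
          (w ∷ []) mid (verts R) (verts T) (below tl′) (below tr))
        (++⁺ˡ mid (prep w (++⁺ʳ (whole tr) (whole-≈ s)))))
      (good-++ (splice w mid toR x∈ ext) (good-++ (default tl′) (default tr)))

    focus-below : below t ↭ (w ∷ []) ++ whole tl ++ whole tr ++ below rest
    focus-below = ↭-trans (++⁺ (_≈_.centers-↭ view) (concatMap-↭ verts (drop-∷ (_≈_.pieces-↭ view))))
      (below-branch w toB toL toR tl tr rest)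

    -- The branch hangs at `p` and `T` is met from `q`, so the root pair fits between `w` and `T` as
    -- a detour.
    focus-through : ∀ {p q x} → verts B ↭ p ∷ q ∷ [] → E p q → E p w → x ∈ verts T → E q x → Good (whole t)
    focus-through {p} {q} B↭ pq pw x∈ qx = good-↭
      (↭-trans (solve 5 (λ B w a b c → (B ⊕ w ⊕ a ⊕ b) ⊕ c ⊜ B ⊕ w ⊕ a ⊕ b ⊕ c) ↭-refl
          (p ∷ q ∷ []) (w ∷ []) (whole tl) (whole tr) (below rest))
        (++⁺ (↭-sym B↭) (↭-sym focus-below)))
      (good-++ (limb (p ∷ q ∷ []) x∈ (λ π → cons (E-sym pw) (cons pq (cons qx π)))) (default rest))

  -- Every branch at a single root hangs at `y`, so `y` itself is a detour from the centre to `T`.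
  single-adjacent : ∀ {y T x} (t : Tree (K1 y)) → T ∈ pieces t → x ∈ verts T → E y x → Good (whole t)
  single-adjacent {y} t T∈ x∈ yx with focus t T∈
  ... | f@(focused {w} (link (here refl) e) _ _ tl tr rest _ _) = good-↭
    (↭-trans (solve 5 (λ B w a b c → (B ⊕ w ⊕ a ⊕ b) ⊕ c ⊜ B ⊕ w ⊕ a ⊕ b ⊕ c) ↭-refl
        (y ∷ []) (w ∷ []) (whole tl) (whole tr) (below rest))
      (prep y (↭-sym (focus-below f))))
    (good-++ (limb f (y ∷ []) x∈ (λ π → cons (E-sym e) (cons yx π))) (default rest))

  -- Since `p` sees every centre, the branch towards `T` can be hung at `p` whichever end it was
  -- linked to.
  pair-adjacent-through : ∀ {B p q T x} (t : Tree B) → verts B ↭ p ∷ q ∷ [] → E p q → (∀ {w} → w ∈ centers t → E p w) →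
                          T ∈ pieces t → x ∈ verts T → E q x → Good (whole t)
  pair-adjacent-through t B↭ pq pw T∈ x∈ qx = focus-through f B↭ pq
      (pw (∈-resp-↭ (↭-sym (_≈_.centers-↭ (Focus.view f))) (here refl))) x∈ qx
    where f = focus t T∈

  -- If the branches towards S and T hang at p and q respectively, the pair is cut and
  -- each of p and q closes up its own branch.
  pair-adjacent-twice : ∀ {B p q S T x y} (t : Tree B) → verts B ↭ p ∷ q ∷ [] → E p q →
    S ∈ pieces t → x ∈ verts S → E p x → T ∈ pieces t → y ∈ verts T → E q y → Good (whole t)
  pair-adjacent-twice {B} {p} {q} {S} {T} {x} {y} t B↭ pq S∈ x∈ px T∈ y∈ qy = go (focus t T∈)
    where
    B↭′ : verts B ↭ q ∷ p ∷ []
    B↭′ = ↭-trans B↭ (swap p q ↭-refl)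

    go : Focus T t → Good (whole t)
    go f@(focused {w} {L} {R} toB@(link b∈ bw) toL toR tl tr rest T∈L view) with ∈-resp-↭ B↭ b∈
    ... | here refl = focus-through f B↭ pq bw y∈ qy
    ... | there (here refl) with ∈-++⁻ (L ∷ pieces tl) (∈-resp-↭ (drop-∷ (_≈_.pieces-↭ view)) S∈)
    ...   | inj₁ S∈L = focus-through (focused toB toL toR tl tr rest S∈L view) B↭′ (E-sym pq) bw x∈ px
    ...   | inj₂ S∈′ with ∈-++⁻ (R ∷ pieces tr) S∈′
    ...     | inj₁ S∈R = focus-through
                (focused toB toR toL tr tl rest S∈R (≈-trans view (swap-≈ w toB toL toR tl tr rest)))
                B↭′ (E-sym pq) bw x∈ px
    ...     | inj₂ S∈rest with focus rest S∈rest
    ...       | g@(focused {w′} toB′@(link b∈′ bw′) _ _ tl′ tr′ rest′ _ _) with ∈-resp-↭ B↭ b∈′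
    -- Both branches hang at `q`: the one towards `T` keeps its default covering, and the one
    -- towards `S` absorbs the pair.
    ...         | there (here refl) = good-↭
                    (↭-trans (solve 5 (λ B w a b c → (w ⊕ a ⊕ b) ⊕ B ⊕ c ⊜ B ⊕ w ⊕ a ⊕ b ⊕ c) ↭-refl
                        (verts B) (w ∷ []) (whole tl) (whole tr) (below rest))
                      (++⁺ˡ (verts B) (↭-sym (focus-below f))))
                    (good-++
                      (limb (focused toB toL toR tl tr rest (here refl) view) [] (end∈ toL) (cons (E-sym (edge toL))))
                      (focus-through g B↭′ (E-sym pq) bw′ x∈ px))
    ...         | here refl = good-↭
                    (↭-trans (solve 9 (λ p q w a b w′ c d r →
                          (q ⊕ w ⊕ a ⊕ b) ⊕ (p ⊕ w′ ⊕ c ⊕ d) ⊕ r ⊜ (p ⊕ q) ⊕ w ⊕ a ⊕ b ⊕ w′ ⊕ c ⊕ d ⊕ r) ↭-refl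
                        (p ∷ []) (q ∷ []) (w ∷ []) (whole tl) (whole tr) (w′ ∷ []) (whole tl′) (whole tr′) (below rest′))
                      (++⁺ (↭-sym B↭) (↭-trans
                        (prep w (++⁺ˡ (whole tl) (++⁺ˡ (whole tr) (↭-sym (focus-below g)))))
                        (↭-sym (focus-below f)))))
                    (good-++ (limb f (q ∷ []) y∈ (λ π → cons (E-sym bw) (cons qy π)))
                      (good-++ (limb g (p ∷ []) x∈ (λ π → cons (E-sym bw′) (cons px π))) (default rest′)))

-- Growing the tree and repacking

module Growth {N : ℕ} (G : Graph N) (E : Fin N → Fin N → Set)
              (E-sym : ∀ {x y} → E x y → E y x) (E? : ∀ x y → Dec (E x y)) where
  open PathPacking G E E-sym

  data Side (w : V) : List V → Set where
    none  : Side w []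
    short : ∀ L → Link w L → Side w (verts L)
    long  : ∀ {xs} → 3 ≤ length xs → Side w xs

  side : ∀ {w} xs → Path (w ∷ xs) → Side w xs
  side []              p                     = none
  side (x ∷ [])        (cons e p)            = short (K1 x) (link (here refl) (E-sym e))
  side (x ∷ y ∷ [])    (cons e (cons e′ p)) = short (K2 x y e′) (link (here refl) (E-sym e))
  side (x ∷ y ∷ z ∷ _) p                     = long (s≤s (s≤s (s≤s z≤n)))

  1≤-verts : ∀ L → 1 ≤ length (verts L)
  1≤-verts (K1 _)     = s≤s z≤n
  1≤-verts (K2 _ _ _) = s≤s z≤n

  -- Cutting a long path at `w` either saves the bad piece `as` or leaves two short halves, which
  -- are exactly the data of a new branch.
  Extension : V → List V → List V → List V → Set
  Extension w as ls rs = Good (as ++ (w ∷ []) ++ ls ++ rs)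
    ⊎ ∃ λ L → ∃ λ R → Link w L × Link w R × ls ≡ verts L × rs ≡ verts R

  Extension-swap : ∀ {w} as {ls rs} → Extension w as ls rs → Extension w as rs ls
  Extension-swap {w} as {ls} {rs} (inj₁ g) = inj₁ (good-↭ (++⁺ˡ as (prep w (++-comm ls rs))) g)
  Extension-swap as (inj₂ (L , R , l , r , p , q)) = inj₂ (R , L , r , l , q , p)

  module _ {x w} {as : List V} (px : Path (x ∷ as)) (e : E x w) where

    bend : ∀ rs → Path (w ∷ rs) → 1 ≤ length rs → Good ((x ∷ as) ++ w ∷ rs)
    bend rs pr 1≤ = good-bent px e pr (s≤s (≤-trans (s≤s 1≤) (m≤n+m (suc (length rs)) (length as))))

    cut-off : ∀ ls rs → Path (w ∷ ls) → Path (w ∷ rs) → 3 ≤ length ls → 1 ≤ length rs →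
              Extension w (x ∷ as) ls rs
    cut-off ls rs pl pr 3≤ 1≤ = inj₁ (good-↭
      (solve 4 (λ a w l r → (a ⊕ w ⊕ r) ⊕ l ⊜ a ⊕ w ⊕ l ⊕ r) ↭-refl (x ∷ as) (w ∷ []) ls rs)
      (good-++ (bend rs pr 1≤) (good-path 3≤ (path-tail pl))))

    -- If a half is empty, the piece prolongs the path at its end `w`. If a half is long, it
    -- survives alone and the piece joins the other half through `w`. Only two short nonempty halves
    -- resist.
    extend : ∀ ls rs → Path (w ∷ ls) → Path (w ∷ rs) → 3 ≤ suc (length ls + length rs) → Extension w (x ∷ as) ls rs
    extend ls rs pl pr (s≤s 2≤) with side ls pl | side rs pr
    ... | none      | _         = inj₁ (bend rs pr (≤-trans (s≤s z≤n) 2≤))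
    ... | short L l | none      = Extension-swap (x ∷ as) (inj₁ (bend ls pl (1≤-verts L)))
    ... | long 3≤   | none      = Extension-swap (x ∷ as) (inj₁ (bend ls pl (≤-trans (s≤s z≤n) 3≤)))
    ... | short L l | short R r = inj₂ (L , R , l , r , refl , refl)
    ... | short L l | long 3≤   = Extension-swap (x ∷ as) (cut-off rs ls pr pl 3≤ (1≤-verts L))
    ... | long 3≤   | short R r = cut-off ls rs pl pr 3≤ (1≤-verts R)
    ... | long 3≤   | long 3≤′  = cut-off ls rs pl pr 3≤ (≤-trans (s≤s z≤n) 3≤′)

  LongPath : List V → Set
  LongPath p = 3 ≤ length p × Path p

  good-paths : ∀ gs → All LongPath gs → Good (concat gs)
  good-paths gs a = good gs (All.map proj₁ a) (All.map proj₂ a) ↭-refl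

  ∈-vertsOf : ∀ ps {x} → x ∈ vertsOf ps → ∃ λ P → P ∈ ps × x ∈ verts P
  ∈-vertsOf ps x∈ = find (∈-concatMap⁻ verts {xs = ps} x∈)

  module _ (σ : List V)
    (stuck : ∀ {B} (t : Tree B) rest → whole t ++ rest ↭ σ →
             (∀ {x y} → x ∈ vertsOf (B ∷ pieces t) → y ∈ rest → ¬ E x y) → Good (whole t)) where

    -- The induction statement on the number of bad pieces. A tree counts as one bad piece, its
    -- root, because everything below has a default covering.
    Improve : ℕ → Set
    Improve d = ∀ {zs} bs → Good zs → length bs ≤ d → zs ++ vertsOf bs ↭ σ → Good σ

    -- Each branching uses up one of the at most k long paths.
    grow : ∀ {d} → Improve d → ∀ k {B} (t : Tree B) gs bs → length gs ≤ k → All LongPath gs → length bs ≤ d →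
           whole t ++ concat gs ++ vertsOf bs ↭ σ → Good σ
    grow {d} improve k {B} t gs bs gs≤k gs-long bs≤d perm
      with any? (λ x → any? (E? x) (concat gs ++ vertsOf bs)) (vertsOf (B ∷ pieces t))
    -- No edge leaves the pieces for the outside, so `stuck` covers the root as well and only `bs`
    -- stays bad.
    ... | no closed = improve bs
          (good-++ (stuck t _ perm (λ x∈ y∈ e → closed (lose x∈ (lose y∈ e)))) (good-paths gs gs-long))
          bs≤d (↭-trans (↭-reflexive (++-assoc (whole t) (concat gs) (vertsOf bs))) perm)
    ... | yes found with find found
    ... | x , x∈ , found′ with find found′ | ∈-vertsOf (B ∷ pieces t) x∈
    ... | y , y∈ , e | Q , Q∈ , x∈Q with reroot t Q∈ | arm Q x∈Q
    ... | t′ , s | as , px , as↭ with ∈-++⁻ (concat gs) y∈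
    ...   | inj₂ y∈bs = meet (∈-vertsOf bs y∈bs)
      where
      meet : (∃ λ P → P ∈ bs × y ∈ verts P) → Good σ
      meet (P , P∈ , y∈P) with ∈⇒↭ P∈ | arm P y∈P
      ... | bs′ , bs↭ | ys , py , ys↭ = join as ys px py perm′
        where
        perm′ : ((x ∷ as) ++ below t′) ++ concat gs ++ (y ∷ ys) ++ vertsOf bs′ ↭ σ
        perm′ = ↭-trans (++⁺ (↭-trans (++⁺ʳ (below t′) as↭) (whole-≈ s))
          (++⁺ˡ (concat gs) (↭-trans (++⁺ʳ (vertsOf bs′) ys↭) (concatMap-↭ verts (↭-sym bs↭))))) perm
        bs′≤d : suc (length bs′) ≤ d
        bs′≤d = subst (_≤ d) (↭-length bs↭) bs≤d
        rest : Good (below t′ ++ concat gs)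
        rest = good-++ (default t′) (good-paths gs gs-long)
        join-long : ∀ as ys → Path (x ∷ as) → Path (y ∷ ys) → 3 ≤ length (x ∷ as) + length (y ∷ ys) →
                    ((x ∷ as) ++ below t′) ++ concat gs ++ (y ∷ ys) ++ vertsOf bs′ ↭ σ → Good σ
        join-long as ys px py 3≤ perm′ = improve bs′ (good-++ (good-bent px e py 3≤) rest)
          (≤-trans (n≤1+n _) bs′≤d)
          (↭-trans (solve 5 (λ x t g y b → ((x ⊕ y) ⊕ t ⊕ g) ⊕ b ⊜ (x ⊕ t) ⊕ g ⊕ y ⊕ b) ↭-refl
            (x ∷ as) (below t′) (concat gs) (y ∷ ys) (vertsOf bs′)) perm′)
        join : ∀ as ys → Path (x ∷ as) → Path (y ∷ ys) →
               ((x ∷ as) ++ below t′) ++ concat gs ++ (y ∷ ys) ++ vertsOf bs′ ↭ σ → Good σ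
        -- Two single vertices are too few for a long path, but merging them into a pair still
        -- lowers the number of bad pieces by one.
        join [] [] px py perm′ = improve (K2 x y e ∷ bs′) rest bs′≤d
          (↭-trans (solve 5 (λ x t g y b → (t ⊕ g) ⊕ (x ⊕ y) ⊕ b ⊜ (x ⊕ t) ⊕ g ⊕ y ⊕ b) ↭-refl
            (x ∷ []) (below t′) (concat gs) (y ∷ []) (vertsOf bs′)) perm′)
        join (a ∷ as) ys px py = join-long (a ∷ as) ys px py
          (s≤s (s≤s (≤-trans (s≤s z≤n) (m≤n+m (suc (length ys)) (length as)))))
        join [] (y′ ∷ ys) px py = join-long [] (y′ ∷ ys) px py (s≤s (s≤s (s≤s z≤n)))
    ...   | inj₁ y∈gs with ∈-concat⁻′ gs y∈gs
    ...     | g , y∈g , g∈ with ∈⇒↭ g∈ | ∈⇒ʳ++ y∈g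
    ...       | gs′ , gs↭ | ls , rs , refl with All-resp-↭ gs↭ gs-long
    ...         | (g-long , g-path) ∷ gs′-long with path-split ls g-path
    ...           | pl , pr with extend px e ls rs pl pr (subst (3 ≤_) (trans (length-ʳ++ ls) (+-suc (length ls) (length rs))) g-long)
    ...             | ext = absorb k gs≤k ext
      where
      perm′ : (verts Q ++ below t′) ++ ((y ∷ []) ++ ls ++ rs) ++ concat gs′ ++ vertsOf bs ↭ σ
      perm′ = ↭-trans (++⁺ (whole-≈ s) (↭-trans
          (↭-trans (++⁺ʳ (concat gs′ ++ vertsOf bs) (↭-trans (↭-sym (shift y ls rs)) (++↭ʳ++ ls (y ∷ rs))))
            (↭-reflexive (sym (++-assoc (ls ʳ++ (y ∷ rs)) (concat gs′) (vertsOf bs)))))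
          (++⁺ʳ (vertsOf bs) (concat-↭ (↭-sym gs↭))))) perm
        where
        concat-↭ : ∀ {xss yss : List (List V)} → xss ↭ yss → concat xss ↭ concat yss
        concat-↭ {xss} {yss} p = subst₂ _↭_ (cong concat (map-id xss)) (cong concat (map-id yss)) (concatMap-↭ (λ xs → xs) p)
      absorb : ∀ k → length gs ≤ k → Extension y (x ∷ as) ls rs → Good σ
      absorb k gs≤k (inj₁ g′) = improve bs (good-++ g′ (good-++ (default t′) (good-paths gs′ gs′-long))) bs≤d
        (↭-trans (solve 5 (λ x t g y b → ((x ⊕ g) ⊕ t ⊕ y) ⊕ b ⊜ (x ⊕ t) ⊕ g ⊕ y ⊕ b) ↭-refl
            (x ∷ as) (below t′) ((y ∷ []) ++ ls ++ rs) (concat gs′) (vertsOf bs))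
          (↭-trans (++⁺ʳ _ (++⁺ʳ (below t′) as↭)) perm′))
      absorb zero    gs≤k (inj₂ _) with () ← subst (_≤ 0) (↭-length gs↭) gs≤k
      absorb (suc k) gs≤k (inj₂ (L , R , l , r , refl , refl)) =
        grow improve k (branch y b l r leaf leaf t′) gs′ bs
          (s≤s⁻¹ (subst (_≤ suc k) (↭-length gs↭) gs≤k)) gs′-long bs≤d
          (↭-trans (++⁺ʳ (concat gs′ ++ vertsOf bs) (++⁺ˡ (verts Q) (below-branch y b l r leaf leaf t′)))
            (↭-trans (solve 6 (λ q y l r t g → (q ⊕ y ⊕ (l ⊕ nil′) ⊕ (r ⊕ nil′) ⊕ t) ⊕ g ⊜ (q ⊕ t) ⊕ (y ⊕ l ⊕ r) ⊕ g) ↭-refl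
              (verts Q) (y ∷ []) (verts L) (verts R) (below t′) (concat gs′ ++ vertsOf bs)) perm′))
        where
        b : Link y Q
        b = link x∈Q e

    repack : ∀ d → Improve d
    repack d       []       g _          p = good-↭ (↭-trans (↭-reflexive (sym (++-identityʳ _))) p) g
    repack (suc d) (B ∷ bs) (good gs l v q) (s≤s bs≤d) p =
      grow (repack d) (length gs) {B} leaf gs bs ≤-refl (All.zip (l , v)) bs≤d
        (↭-trans (solve 3 (λ B g b → (B ⊕ nil′) ⊕ g ⊕ b ⊜ g ⊕ B ⊕ b) ↭-refl (verts B) (concat gs) (vertsOf bs))
          (↭-trans (++⁺ʳ _ q) p))

    good-all : Good σ
    -- The initial covering has no long path: every vertex is a bad piece of its own.
    good-all = repack (length (map K1 σ)) (map K1 σ) good-[] ≤-refl (↭-reflexive (singles σ))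
      where
      singles : ∀ xs → vertsOf (map K1 xs) ≡ xs
      singles []       = refl
      singles (x ∷ xs) = cong (x ∷_) (singles xs)

-- Deleting a list of vertices

unique-↭ : ∀ {A : Set} {xs ys : List A} → xs ↭ ys → Unique xs → Unique ys
unique-↭ p = Unique-resp-↭ (setoid _) (↭⇒↭ₛ p)

unique-++⁻ : ∀ {A : Set} (xs : List A) {ys} → Unique (xs ++ ys) → Unique xs × Unique ys × Disjoint xs ys
unique-++⁻ []       q = [] , q , λ ()
unique-++⁻ (x ∷ xs) (px ∷ q) with unique-++⁻ xs q | All.++⁻ xs px
... | qx , qy , d | pxs , pys = pxs ∷ qx , qy ,
  λ { (here refl , x∈) → All.lookup pys x∈ refl ; (there x∈ , y∈) → d (x∈ , y∈) }

∣p∪q∣≤∣p∣+∣q∣ : ∀ {n} (p q : Subset n) → ∣ p ∪ q ∣ ≤ ∣ p ∣ + ∣ q ∣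
∣p∪q∣≤∣p∣+∣q∣ []            []            = z≤n
∣p∪q∣≤∣p∣+∣q∣ (inside  ∷ p) (inside  ∷ q) = s≤s (≤-trans (∣p∪q∣≤∣p∣+∣q∣ p q) (+-monoʳ-≤ ∣ p ∣ (n≤1+n ∣ q ∣)))
∣p∪q∣≤∣p∣+∣q∣ (inside  ∷ p) (outside ∷ q) = s≤s (∣p∪q∣≤∣p∣+∣q∣ p q)
∣p∪q∣≤∣p∣+∣q∣ (outside ∷ p) (inside  ∷ q) = ≤-trans (s≤s (∣p∪q∣≤∣p∣+∣q∣ p q)) (≤-reflexive (sym (+-suc ∣ p ∣ ∣ q ∣)))
∣p∪q∣≤∣p∣+∣q∣ (outside ∷ p) (outside ∷ q) = ∣p∪q∣≤∣p∣+∣q∣ p q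

-- Repetitions in the list are harmless, since only an upper bound on the size of the result is
-- used.
_⊕ˢ_ : ∀ {n} → Subset n → List (Fin n) → Subset n
p ⊕ˢ []       = p
p ⊕ˢ (x ∷ xs) = ⁅ x ⁆ ∪ (p ⊕ˢ xs)

∣p⊕ˢxs∣≤ : ∀ {n} (p : Subset n) xs → ∣ p ⊕ˢ xs ∣ ≤ ∣ p ∣ + length xs
∣p⊕ˢxs∣≤ p []       = ≤-reflexive (sym (+-identityʳ ∣ p ∣))
∣p⊕ˢxs∣≤ p (x ∷ xs) = ≤-trans (∣p∪q∣≤∣p∣+∣q∣ ⁅ x ⁆ (p ⊕ˢ xs))
  (≤-trans (+-mono-≤ (≤-reflexive (∣⁅x⁆∣≡1 x)) (∣p⊕ˢxs∣≤ p xs)) (≤-reflexive (sym (+-suc ∣ p ∣ (length xs)))))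

∈-⊕ˢ⁻ : ∀ {n} {p : Subset n} xs {x} → x ∈ˢ p ⊕ˢ xs → x ∈ˢ p ⊎ x ∈ xs
∈-⊕ˢ⁻ []       x∈ = inj₁ x∈
∈-⊕ˢ⁻ {p = p} (y ∷ xs) x∈ with x∈p∪q⁻ ⁅ y ⁆ (p ⊕ˢ xs) x∈
... | inj₁ x∈y = inj₂ (here (x∈⁅y⁆⇒x≡y y x∈y))
... | inj₂ x∈′ = ⊎-map₂ there (∈-⊕ˢ⁻ xs x∈′)

∈-⊕ˢ⁺ˡ : ∀ {n} {p : Subset n} xs {x} → x ∈ˢ p → x ∈ˢ p ⊕ˢ xs
∈-⊕ˢ⁺ˡ []       x∈ = x∈
∈-⊕ˢ⁺ˡ (y ∷ xs) x∈ = x∈p∪q⁺ {p = ⁅ y ⁆} (inj₂ (∈-⊕ˢ⁺ˡ xs x∈))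

∈-⊕ˢ⁺ʳ : ∀ {n} {p : Subset n} {xs x} → x ∈ xs → x ∈ˢ p ⊕ˢ xs
∈-⊕ˢ⁺ʳ {xs = y ∷ xs} (here refl) = x∈p∪q⁺ {p = ⁅ y ⁆} (inj₁ (x∈⁅x⁆ y))
∈-⊕ˢ⁺ʳ {xs = y ∷ xs} (there x∈)  = x∈p∪q⁺ {p = ⁅ y ⁆} (inj₂ (∈-⊕ˢ⁺ʳ x∈))

∉-⊕ˢ : ∀ {n} {p : Subset n} xs {x} → x ∉ˢ p → x ∉ xs → x ∉ˢ p ⊕ˢ xs
∉-⊕ˢ xs x∉p x∉xs x∈ = [ x∉p , x∉xs ]′ (∈-⊕ˢ⁻ xs x∈)

unique⇒length≤∣p∣ : ∀ {n} (p : Subset n) {xs} → Unique xs → (∀ {x} → x ∈ xs → x ∈ˢ p) → length xs ≤ ∣ p ∣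
unique⇒length≤∣p∣ p {[]}     _        _   = z≤n
unique⇒length≤∣p∣ p {x ∷ xs} (x∉ ∷ u) xs⊆ = ≤-trans
  (s≤s (unique⇒length≤∣p∣ (p - x) u (λ y∈ → x∈p∧x≢y⇒x∈p-y (xs⊆ (there y∈)) (All.lookup x∉ y∈ ∘ sym))))
  (x∈p⇒∣p-x∣<∣p∣ (xs⊆ (here refl)))

∣p∣<n⇒∃∉ : ∀ {n} (p : Subset n) → ∣ p ∣ < n → ∃ λ x → x ∉ˢ p
∣p∣<n⇒∃∉ {n} p p<n with nonempty? (∁ p)
... | yes (x , x∈) = x , x∈∁p⇒x∉p x∈
... | no empty     = contradiction (trans (sym (∣∁p∣≡n∸∣p∣ p)) (trans (cong ∣_∣ (Empty-unique empty)) (∣⊥∣≡0 n)))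
                       (m<n⇒n∸m≢0 p<n)
  where
  m<n⇒n∸m≢0 : ∀ {m n} → m < n → n ∸ m ≢ 0
  m<n⇒n∸m≢0 m<n eq = <⇒≱ m<n (m∸n≡0⇒m≤n eq)

allB-true : ∀ {A : Set} {p : A → Bool} xs → (∀ x → p x ≡ true) → allB p xs ≡ true
allB-true []       h = refl
allB-true (x ∷ xs) h rewrite h x = allB-true xs h

∈-isolatedSet : ∀ {N} (G : Graph N) (X : Subset N) {x} → x ∉ˢ X → (∀ y → adj G x y ≡ true → y ∈ˢ X) → x ∈ˢ isolatedSet G X
∈-isolatedSet {N} G X {x} x∉ nb = lookup⇒[]= x _ (trans (lookup∘tabulate _ x)
    (cong₂ _∧_ outer (allB-true (allFin N) inner)))
  where
  outer : not (lookup X x) ≡ true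
  outer with lookup X x in eq
  ... | false = refl
  ... | true  = contradiction (lookup⇒[]= x X eq) x∉
  inner : ∀ y → (not (adj G y x) ∨ lookup X y) ≡ true
  inner y with adj G y x in eq
  ... | false = refl
  ... | true  = []=⇒lookup (nb y (trans (Graph.sym G x y) eq))

module Deletion (n r : ℕ) {N : ℕ} (G : Graph N) (W : Subset N) (W≡n : ∣ W ∣ ≡ n) where

  module _ (conn : KConnected G (n + r + 2)) where

    fresh : ∀ D → length D ≤ r + 2 → ∃ λ z → z ∉ˢ W × z ∉ D
    fresh D D≤ with ∣p∣<n⇒∃∉ (W ⊕ˢ D) (≤-<-trans (∣p⊕ˢxs∣≤ W D)
        (≤-<-trans (+-mono-≤ (≤-reflexive W≡n) D≤) (subst (_< N) (+-assoc n r 2) (proj₁ conn))))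
    ... | z , z∉ = z , z∉ ∘ ∈-⊕ˢ⁺ˡ D , z∉ ∘ ∈-⊕ˢ⁺ʳ

    -- `W` and `D` have fewer than `n + r + 2` vertices together, so what remains is connected and a
    -- property preserved along its edges spreads everywhere. Separation arguments take `P` to be
    -- membership in a supposed component.
    reaches : ∀ D → length D ≤ r + 1 → (P : Fin N → Set) →
              (∀ {a b} → P a → adj G a b ≡ true → b ∉ˢ W → b ∉ D → P b) →
              ∀ {x z} → x ∉ˢ W → x ∉ D → P x → z ∉ˢ W → z ∉ D → P z
    reaches D D≤ P closed {x} {z} x∉W x∉D px z∉W z∉D =
      walk (proj₂ conn (W ⊕ˢ D) small x z (x∉p⇒x∈∁p (∉-⊕ˢ D x∉W x∉D)) (x∉p⇒x∈∁p (∉-⊕ˢ D z∉W z∉D))) px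
      where
      small : ∣ W ⊕ˢ D ∣ < n + r + 2
      small = ≤-<-trans (∣p⊕ˢxs∣≤ W D) (≤-<-trans (+-mono-≤ (≤-reflexive W≡n) D≤)
        (≤-reflexive (lemma n r)))
        where
        lemma : ∀ n r → suc (n + (r + 1)) ≡ n + r + 2
        lemma = solve-∀
      start : ∀ {a b} → Reach G (∁ (W ⊕ˢ D)) a b → a ∉ˢ W ⊕ˢ D
      start (here a∈)     = x∈∁p⇒x∉p a∈
      start (step a∈ _ _) = x∈∁p⇒x∉p a∈
      walk : ∀ {a b} → Reach G (∁ (W ⊕ˢ D)) a b → P a → P b
      walk (here _)         pa = pa
      walk (step _ ab rest) pa = walk rest (closed pa ab (start rest ∘ ∈-⊕ˢ⁺ˡ D) (start rest ∘ ∈-⊕ˢ⁺ʳ))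

  -- Deleting `W` and `Y` isolates all of `I`. As `I` has no repetitions, its length is a lower
  -- bound for the number of isolated vertices.
  toughness-bound : ∀ {a b} → IsolatedToughnessGt G a b → ∀ I Y → Unique I → 2 ≤ length I →
    (∀ {x} → x ∈ I → x ∉ˢ W) → Disjoint I Y → (∀ {x y} → x ∈ I → y ∉ˢ W → adj G x y ≡ true → y ∈ Y) →
    a * length I < b * (n + length Y)
  toughness-bound {a} {b} tough I Y uniq 2≤ I∉W I∉Y nb =
    ≤-<-trans (*-monoʳ-≤ a I≤) (<-≤-trans (tough (W ⊕ˢ Y) (≤-trans 2≤ I≤))
      (*-monoʳ-≤ b (≤-trans (∣p⊕ˢxs∣≤ W Y) (+-monoˡ-≤ (length Y) (≤-reflexive W≡n)))))
    where
    nb′ : ∀ {x} → x ∈ I → ∀ y → adj G x y ≡ true → y ∈ˢ W ⊕ˢ Y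
    nb′ x∈ y xy with y ∈ˢ? W
    ... | yes y∈ = ∈-⊕ˢ⁺ˡ Y y∈
    ... | no y∉  = ∈-⊕ˢ⁺ʳ (nb x∈ y∉ xy)
    I≤ : length I ≤ iso G (W ⊕ˢ Y)
    I≤ = unique⇒length≤∣p∣ _ uniq (λ x∈ → ∈-isolatedSet G _ (∉-⊕ˢ Y (I∉W x∈) (λ x∈Y → I∉Y (x∈ , x∈Y))) (nb′ x∈))

-- The threshold is n/(2q) + 3/2 with q = r + 2. Isolating i vertices by n + k deletions gives the
-- ratio n/i + k/i, whose terms are at most n/(2q) and 3/2; everything is cross-multiplied.
toughness-contradiction : ∀ n q i k → 2 * q ≤ i → 2 * k ≤ 3 * i → ¬ ((n + 3 * q) * i < 2 * q * (n + k))
toughness-contradiction n q i k 2q≤i 2k≤3i lt = <⇒≱ lt (begin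
  2 * q * (n + k)         ≡⟨ lemma₁ n q k ⟩
  2 * q * n + q * (2 * k) ≤⟨ +-mono-≤ (*-monoˡ-≤ n 2q≤i) (*-monoʳ-≤ q 2k≤3i) ⟩
  i * n + q * (3 * i)     ≡⟨ lemma₂ n q i ⟩
  (n + 3 * q) * i         ∎)
  where
  open ≤-Reasoning
  lemma₁ : ∀ n q k → 2 * q * (n + k) ≡ 2 * q * n + q * (2 * k)
  lemma₁ = solve-∀
  lemma₂ : ∀ n q i → i * n + q * (3 * i) ≡ (n + 3 * q) * i
  lemma₂ = solve-∀

-- With m centres and t pairs, the left-hand sides are twice the number of deleted vertices outside W
-- and the right-hand sides three times the number of isolated ones.
module _ (m t : ℕ) where
  open ≤-Reasoning
  no-single-count : t ≤ 1 + 2 * m → 2 * (m + t) ≤ 3 * (1 + 2 * m)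
  no-single-count h = begin
    2 * (m + t)             ≤⟨ *-monoʳ-≤ 2 (+-monoʳ-≤ m h) ⟩
    2 * (m + (1 + 2 * m))   ≤⟨ m≤m+n _ 1 ⟩
    2 * (m + (1 + 2 * m)) + 1 ≡⟨ lemma m ⟩
    3 * (1 + 2 * m)         ∎
    where
    lemma : ∀ m → 2 * (m + (1 + 2 * m)) + 1 ≡ 3 * (1 + 2 * m)
    lemma = solve-∀
  one-single-count : t ≤ 2 * m → 2 * (1 + (m + t)) ≤ 3 * (1 + 2 * m)
  one-single-count h = begin
    2 * (1 + (m + t))       ≤⟨ *-monoʳ-≤ 2 (s≤s (+-monoʳ-≤ m h)) ⟩
    2 * (1 + (m + 2 * m))   ≤⟨ m≤m+n _ 1 ⟩
    2 * (1 + (m + 2 * m)) + 1 ≡⟨ lemma m ⟩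
    3 * (1 + 2 * m)         ∎
    where
    lemma : ∀ m → 2 * (1 + (m + 2 * m)) + 1 ≡ 3 * (1 + 2 * m)
    lemma = solve-∀
  two-singles-count : 1 + t ≤ 2 * m → 2 * (1 + (m + t)) ≤ 3 * (2 * m)
  two-singles-count h = begin
    2 * (1 + (m + t))       ≡⟨ lemma m t ⟩
    2 * (m + (1 + t))       ≤⟨ *-monoʳ-≤ 2 (+-monoʳ-≤ m h) ⟩
    2 * (m + 2 * m)         ≡⟨ lemma′ m ⟩
    3 * (2 * m)             ∎
    where
    lemma : ∀ m t → 2 * (1 + (m + t)) ≡ 2 * (m + (1 + t))
    lemma = solve-∀
    lemma′ : ∀ m → 2 * (m + 2 * m) ≡ 3 * (2 * m)
    lemma′ = solve-∀

-- Trees that cannot grow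

module StuckTree (n r N : ℕ) (G : Graph N) (conn : KConnected G (n + r + 2))
                 (tough : IsolatedToughnessGt G (n + 3 * (r + 2)) (2 * (r + 2)))
                 (W : Subset N) (W≡n : ∣ W ∣ ≡ n) (u v : Fin N) (uv : adj G u v ≡ true) where

  open Deletion n r G W W≡n
  open import Data.List.Membership.DecPropositional (_≟_ {N}) using (_∈?_)

  E : Fin N → Fin N → Set
  E = EdgeAvoiding G u v

  E-sym : ∀ {x y} → E x y → E y x
  E-sym {x} {y} (xy , ¬uv , ¬vu) = trans (Graph.sym G y x) xy , ¬vu ∘ ×-swap , ¬uv ∘ ×-swap

  E? : ∀ x y → Dec (E x y)
  E? x y = (adj G x y Bool.≟ true) ×-dec ¬? ((x ≟ u) ×-dec (y ≟ v)) ×-dec ¬? ((x ≟ v) ×-dec (y ≟ u))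

  adj-irrefl : ∀ {x y} → adj G x y ≡ true → x ≢ y
  adj-irrefl {x} xy refl with () ← trans (sym xy) (irrfl G x)

  E-irrefl : ∀ {x} → ¬ E x x
  E-irrefl e = adj-irrefl (proj₁ e) refl

  -- Describes the removed edge by ends `c` and `d`, so that one argument about an end `c` serves
  -- both `u` and `v`.
  Joins : Fin N → Fin N → Set
  Joins c d = ∀ {x y} → adj G x y ≡ true → E x y ⊎ (x ≡ c × y ≡ d) ⊎ (x ≡ d × y ≡ c)

  joins-uv : Joins u v
  joins-uv {x} {y} xy with (x ≟ u) ×-dec (y ≟ v) | (x ≟ v) ×-dec (y ≟ u)
  ... | yes p | _     = inj₂ (inj₁ p)
  ... | no _  | yes p = inj₂ (inj₂ p)
  ... | no ¬p | no ¬q = inj₁ (xy , ¬p , ¬q)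

  joins-vu : Joins v u
  joins-vu xy = ⊎-map₂ ⊎-swap (joins-uv xy)

  open PathPacking G E E-sym
  open Growth G E E-sym E? using (∈-vertsOf)

  σ : List (Fin N)
  σ = filter (λ x → ¬? (x ∈ˢ? W)) (allFin N)

  ∈σ⁺ : ∀ {x} → x ∉ˢ W → x ∈ σ
  ∈σ⁺ x∉ = ∈-filter⁺ (λ x → ¬? (x ∈ˢ? W)) (∈-allFin _) x∉

  ∈σ⁻ : ∀ {x} → x ∈ σ → x ∉ˢ W
  ∈σ⁻ x∈ = proj₂ (∈-filter⁻ (λ x → ¬? (x ∈ˢ? W)) {xs = allFin N} x∈)

  σ-unique : Unique σ
  σ-unique = filter⁺ (λ x → ¬? (x ∈ˢ? W)) (allFin⁺ N)

  Avoids : Piece → Set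
  Avoids Q = u ∉ verts Q × v ∉ verts Q

  avoids? : ∀ Q → Dec (Avoids Q)
  avoids? Q = ¬? (u ∈? verts Q) ×-dec ¬? (v ∈? verts Q)

  avoiding-edge : ∀ {x y} → x ≢ u → x ≢ v → adj G x y ≡ true → E x y
  avoiding-edge x≢u x≢v xy = xy , x≢u ∘ proj₁ , x≢v ∘ proj₁

  -- Each branch adds one centre and two pieces; with the root, m centres come with 2m + 1 pieces.
  length-pieces : ∀ {B} (t : Tree B) → length (pieces t) ≡ 2 * length (centers t)
  length-pieces leaf = refl
  length-pieces (branch w {L} {R} _ _ _ tl tr t)
    rewrite length-++ (L ∷ pieces tl) {(R ∷ pieces tr) ++ pieces t} | length-++ (R ∷ pieces tr) {pieces t}
          | length-++ (centers tl) {centers tr ++ centers t} | length-++ (centers tr) {centers t}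
          | length-pieces tl | length-pieces tr | length-pieces t =
    lemma (length (centers tl)) (length (centers tr)) (length (centers t))
    where
    lemma : ∀ a b c → suc (2 * a) + (suc (2 * b) + 2 * c) ≡ 2 * suc (a + (b + c))
    lemma = solve-∀

  same-piece : ∀ ps {P Q x} → Unique (vertsOf ps) → P ∈ ps → Q ∈ ps → x ∈ verts P → x ∈ verts Q → P ≡ Q
  same-piece (S ∷ ps) uniq P∈ Q∈ x∈P x∈Q with unique-++⁻ (verts S) uniq | P∈ | Q∈
  ... | _ , _ , d  | here refl | here refl = refl
  ... | _ , _ , d  | here refl | there Q∈′ = ⊥-elim (d (x∈P , ∈-concatMap⁺ verts (lose Q∈′ x∈Q)))
  ... | _ , _ , d  | there P∈′ | here refl = ⊥-elim (d (x∈Q , ∈-concatMap⁺ verts (lose P∈′ x∈P)))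
  ... | _ , uq , _ | there P∈′ | there Q∈′ = same-piece ps uq P∈′ Q∈′ x∈P x∈Q

  -- Closed trees and tame pieces.

  module Closed {B} (t : Tree B) (rest : List (Fin N)) (perm : whole t ++ rest ↭ σ)
                (closed : ∀ {x y} → x ∈ vertsOf (B ∷ pieces t) → y ∈ rest → ¬ E x y) where

    ps : List Piece
    ps = B ∷ pieces t

    X : List (Fin N)
    X = centers t

    perm′ : (X ++ vertsOf ps) ++ rest ↭ σ
    perm′ = ↭-trans (solve 4 (λ B x p r → (x ⊕ B ⊕ p) ⊕ r ⊜ (B ⊕ x ⊕ p) ⊕ r) ↭-refl
      (verts B) X (vertsOf (pieces t)) rest) perm

    unique-X-ps : Unique (X ++ vertsOf ps)
    unique-X-ps = proj₁ (unique-++⁻ (X ++ vertsOf ps) (unique-↭ (↭-sym perm′) σ-unique))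

    unique-ps : Unique (vertsOf ps)
    unique-ps = proj₁ (proj₂ (unique-++⁻ X unique-X-ps))

    disjoint-X-ps : Disjoint X (vertsOf ps)
    disjoint-X-ps = proj₂ (proj₂ (unique-++⁻ X unique-X-ps))

    X∉W : ∀ {x} → x ∈ X → x ∉ˢ W
    X∉W x∈ = ∈σ⁻ (∈-resp-↭ perm′ (∈-++⁺ˡ (∈-++⁺ˡ x∈)))

    ps∉W : ∀ {x} → x ∈ vertsOf ps → x ∉ˢ W
    ps∉W x∈ = ∈σ⁻ (∈-resp-↭ perm′ (∈-++⁺ˡ (∈-++⁺ʳ X x∈)))

    neighbour : ∀ {x y} → x ∈ vertsOf ps → y ∉ˢ W → E x y → y ∈ X ⊎ y ∈ vertsOf ps
    neighbour x∈ y∉ e = [ ∈-++⁻ X , (λ y∈ → ⊥-elim (closed x∈ y∈ e)) ]′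
      (∈-++⁻ (X ++ vertsOf ps) (∈-resp-↭ (↭-sym perm′) (∈σ⁺ y∉)))

    ∈-ps : ∀ {Q x} → Q ∈ ps → x ∈ verts Q → x ∈ vertsOf ps
    ∈-ps Q∈ x∈ = ∈-concatMap⁺ verts (lose Q∈ x∈)

    Out : Piece → Fin N → Set
    Out Q x = Any (λ y → y ∉ verts Q × E x y) (vertsOf ps)

    out? : ∀ Q x → Dec (Out Q x)
    out? Q x = any? (λ y → ¬? (y ∈? verts Q) ×-dec E? x y) (vertsOf ps)

    Tame : Piece → Set
    Tame (K1 x)     = ¬ Out (K1 x) x
    Tame (K2 p q e) = ¬ (Out (K2 p q e) p × Out (K2 p q e) q)

    out⇒piece : ∀ {Q x} (t′ : Tree Q) → t′ ≈ t → Out Q x → ∃ λ T → ∃ λ y → T ∈ pieces t′ × y ∈ verts T × E x y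
    out⇒piece {Q} t′ s out with find out
    ... | y , y∈ , y∉Q , e with ∈-vertsOf ps y∈
    ... | T , T∈ , y∈T with ∈-resp-↭ (↭-sym (_≈_.pieces-↭ s)) T∈
    ... | here refl = ⊥-elim (y∉Q y∈T)
    ... | there T∈′ = T , y , T∈′ , y∈T , e

    -- Rerooting at `Q` moves the offending edges to the root, where `single-adjacent` or
    -- `pair-adjacent-twice` covers the whole tree.
    tame-or-good : ∀ {Q} → Q ∈ ps → Good (whole t) ⊎ Tame Q
    tame-or-good {Q} Q∈ with reroot t Q∈
    tame-or-good {K1 x} Q∈ | t′ , s with out? (K1 x) x
    ... | no ¬out = inj₂ ¬out
    ... | yes out with out⇒piece t′ s out
    ...   | T , y , T∈ , y∈ , e = inj₁ (good-↭ (whole-≈ s) (single-adjacent t′ T∈ y∈ e))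
    tame-or-good {K2 p q e} Q∈ | t′ , s with out? (K2 p q e) p | out? (K2 p q e) q
    ... | no ¬out | _       = inj₂ (¬out ∘ proj₁)
    ... | yes _   | no ¬out = inj₂ (¬out ∘ proj₂)
    ... | yes op  | yes oq with out⇒piece t′ s op | out⇒piece t′ s oq
    ...   | S , x , S∈ , x∈ , px | T , y , T∈ , y∈ , qy =
      inj₁ (good-↭ (whole-≈ s) (pair-adjacent-twice t′ ↭-refl e S∈ x∈ px T∈ y∈ qy))

    all-tame-or-good : ∀ qs → (∀ {Q} → Q ∈ qs → Q ∈ ps) → Good (whole t) ⊎ (∀ {Q} → Q ∈ qs → Tame Q)
    all-tame-or-good []       qs⊆ = inj₂ λ ()
    all-tame-or-good (Q ∷ qs) qs⊆ with tame-or-good (qs⊆ (here refl)) | all-tame-or-good qs (qs⊆ ∘ there)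
    ... | inj₁ g | _      = inj₁ g
    ... | inj₂ _ | inj₁ g = inj₁ g
    ... | inj₂ τ | inj₂ τs = inj₂ λ { (here refl) → τ ; (there Q∈) → τs Q∈ }

    -- Isolating the leaves of a tree with at least r + 2 centres.

    module Tamed (tame : ∀ {Q} → Q ∈ ps → Tame Q) where

      -- Every piece contributes its leaf to the isolated set and its core to the deleted set;
      -- the core of the piece containing c is c whenever that piece is a pair.
      module Oriented (c : Fin N) where

        -- Decides whether `p` is the core: `c` has priority, then an end that sees other pieces.
        first? : ∀ p q e → Dec (p ≡ c ⊎ (q ≢ c × Out (K2 p q e) p))
        first? p q e = (p ≟ c) ⊎-dec (¬? (q ≟ c) ×-dec out? (K2 p q e) p)

        orient : Piece → Fin N × List (Fin N)
        orient (K1 x)     = x , []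
        orient (K2 p q e) with first? p q e
        ... | yes _ = q , p ∷ []
        ... | no _  = p , q ∷ []

        leafOf : Piece → Fin N
        leafOf = proj₁ ∘ orient

        coreOf : Piece → List (Fin N)
        coreOf = proj₂ ∘ orient

        leaves cores Y : List (Fin N)
        leaves = map leafOf ps
        cores = concatMap coreOf ps
        Y = X ++ cores

        verts-orient : ∀ Q → verts Q ↭ leafOf Q ∷ coreOf Q
        verts-orient (K1 x) = ↭-refl
        verts-orient (K2 p q e) with first? p q e
        ... | yes _ = swap p q ↭-refl
        ... | no _  = ↭-refl

        leafOf≡c : ∀ Q → leafOf Q ≡ c → Q ≡ K1 c
        leafOf≡c (K1 x) refl = refl
        leafOf≡c (K2 p q e) eq with first? p q e
        ... | yes (inj₁ refl)     = ⊥-elim (E-irrefl (subst (E p) eq e))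
        ... | yes (inj₂ (q≢c , _)) = ⊥-elim (q≢c eq)
        ... | no ¬first           = ⊥-elim (¬first (inj₁ eq))

        -- A tame pair sees other pieces from at most one end, and that end is the core unless `c`
        -- has claimed the place.
        out-core : ∀ Q {x} → Tame Q → x ∈ verts Q → Out Q x → x ∈ coreOf Q ⊎ c ∈ coreOf Q
        out-core (K1 x) τ (here refl) out = ⊥-elim (τ out)
        out-core (K2 p q e) τ x∈ out with first? p q e | x∈
        ... | yes (inj₁ refl)     | _                 = inj₂ (here refl)
        ... | yes (inj₂ (_ , op)) | here refl         = inj₁ (here refl)
        ... | yes (inj₂ (_ , op)) | there (here refl) = ⊥-elim (τ (op , out))
        ... | no _                | there (here refl) = inj₁ (here refl)
        ... | no ¬first           | here refl with q ≟ c
        ...   | yes refl = inj₂ (here refl)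
        ...   | no q≢c   = ⊥-elim (¬first (inj₂ (q≢c , out)))

        split-↭ : ∀ qs → vertsOf qs ↭ map leafOf qs ++ concatMap coreOf qs
        split-↭ []       = ↭-refl
        split-↭ (Q ∷ qs) = ↭-trans (++⁺ (verts-orient Q) (split-↭ qs))
          (solve 4 (λ l c ls cs → (l ⊕ c) ⊕ ls ⊕ cs ⊜ (l ⊕ ls) ⊕ c ⊕ cs) ↭-refl
            [ leafOf Q ] (coreOf Q) (map leafOf qs) (concatMap coreOf qs))

        leaves-Y : Unique leaves × Unique Y × Disjoint leaves Y
        leaves-Y = unique-++⁻ leaves (unique-↭ (↭-trans (++⁺ˡ X (split-↭ ps))
          (solve 3 (λ x l c → x ⊕ l ⊕ c ⊜ l ⊕ x ⊕ c) ↭-refl X leaves cores)) unique-X-ps)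

        leaf∈ps : ∀ {x} → x ∈ leaves → x ∈ vertsOf ps
        leaf∈ps x∈ = ∈-resp-↭ (↭-sym (split-↭ ps)) (∈-++⁺ˡ x∈)

        leafOf∈ : ∀ Q → leafOf Q ∈ verts Q
        leafOf∈ Q = ∈-resp-↭ (↭-sym (verts-orient Q)) (here refl)

        coreOf∈ : ∀ Q {x} → x ∈ coreOf Q → x ∈ verts Q
        coreOf∈ Q x∈ = ∈-resp-↭ (↭-sym (verts-orient Q)) (there x∈)

        core∈Y : ∀ {Q x} → Q ∈ ps → x ∈ coreOf Q → x ∈ Y
        core∈Y Q∈ x∈ = ∈-++⁺ʳ X (∈-concatMap⁺ coreOf (lose Q∈ x∈))

        -- Two different pieces cannot both have `c` in their cores, so along an edge between them
        -- the exception in `out-core` applies to one side only. The leaf side needs it, hence the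
        -- other end is a core.
        leaf-neighbour-piece : ∀ {Q S y} → Q ∈ ps → S ∈ ps → y ∈ verts S → E (leafOf Q) y → y ∈ Y
        leaf-neighbour-piece {Q} {S} {y} Q∈ S∈ y∈S e = go (y ∈? verts Q)
          where
          leaf∈Q : leafOf Q ∈ verts Q
          leaf∈Q = leafOf∈ Q

          coincide : ∀ {z} → z ∈ verts Q → z ∈ verts S → y ∈ verts Q
          coincide z∈Q z∈S = subst (λ P → y ∈ verts P) (sym (same-piece ps unique-ps Q∈ S∈ z∈Q z∈S)) y∈S

          own : y ∈ leafOf Q ∷ coreOf Q → y ∈ Y
          own (here eq)   = ⊥-elim (E-irrefl (subst (E (leafOf Q)) eq e))
          own (there y∈c) = core∈Y Q∈ y∈c

          other : y ∉ verts Q → leafOf Q ∈ coreOf Q ⊎ c ∈ coreOf Q → y ∈ coreOf S ⊎ c ∈ coreOf S → y ∈ Y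
          other y∉Q _          (inj₁ y∈c) = core∈Y S∈ y∈c
          other y∉Q (inj₂ c∈Q) (inj₂ c∈S) = ⊥-elim (y∉Q (coincide (coreOf∈ Q c∈Q) (coreOf∈ S c∈S)))
          other y∉Q (inj₁ l∈c) (inj₂ _)   =
            ⊥-elim (proj₂ (proj₂ leaves-Y) (∈-map⁺ leafOf Q∈ , core∈Y Q∈ l∈c))

          go : Dec (y ∈ verts Q) → y ∈ Y
          go (yes y∈Q) = own (∈-resp-↭ (verts-orient Q) y∈Q)
          go (no y∉Q)  = other y∉Q
            (out-core Q (tame Q∈) leaf∈Q (lose (∈-ps S∈ y∈S) (y∉Q , e)))
            (out-core S (tame S∈) y∈S (lose (∈-ps Q∈ leaf∈Q) ((λ l∈S → y∉Q (coincide leaf∈Q l∈S)) , E-sym e)))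

        leaf-neighbour : ∀ {x y} → x ∈ leaves → y ∉ˢ W → E x y → y ∈ Y
        leaf-neighbour x∈ y∉ e with ∈-map⁻ leafOf x∈
        ... | Q , Q∈ , refl = [ ∈-++⁺ˡ , (λ y∈ → let S , S∈ , y∈S = ∈-vertsOf ps y∈ in leaf-neighbour-piece Q∈ S∈ y∈S e) ]′
                (neighbour (∈-ps Q∈ (leafOf∈ Q)) y∉ e)

        length-cores : ∀ qs → length (concatMap coreOf qs) ≤ length qs
        length-cores [] = z≤n
        length-cores (Q ∷ qs) = ≤-trans (≤-reflexive (length-++ (coreOf Q)))
            (+-mono-≤ (length-coreOf Q) (length-cores qs))
          where
          length-coreOf : ∀ Q → length (coreOf Q) ≤ 1
          length-coreOf (K1 x) = z≤n
          length-coreOf (K2 p q e) with first? p q e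
          ... | yes _ = ≤-refl
          ... | no _  = ≤-refl

        length-cores-↭ : ∀ {qs rs} → qs ↭ rs → length (concatMap coreOf qs) ≡ length (concatMap coreOf rs)
        length-cores-↭ p = ↭-length (concatMap-↭ coreOf p)

        length-leaves : length leaves ≡ 1 + 2 * length X
        length-leaves = trans (length-map leafOf ps) (cong suc (length-pieces t))

        leaf≡c⇒K1 : c ∈ leaves → K1 c ∈ ps
        leaf≡c⇒K1 c∈ with ∈-map⁻ leafOf c∈
        ... | Q , Q∈ , eq = subst (_∈ ps) (leafOf≡c Q (sym eq)) Q∈

        module Large (large : r + 2 ≤ length X) where

          bound : ∀ I Z → Unique I → (∀ {x} → x ∈ I → x ∈ leaves) → Disjoint I Z →
                  (∀ {x y} → x ∈ I → y ∉ˢ W → adj G x y ≡ true → y ∈ Z) →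
                  2 * length X ≤ length I → 2 * length Z ≤ 3 * length I → ⊥
          bound I Z uniq I⊆ I∉Z nb 2X≤ 2Z≤ = toughness-contradiction n (r + 2) (length I) (length Z)
            2q≤ 2Z≤ (toughness-bound {n + 3 * (r + 2)} {2 * (r + 2)} tough I Z uniq (≤-trans 2≤2q 2q≤) (ps∉W ∘ leaf∈ps ∘ I⊆) I∉Z nb)
            where
            2q≤ : 2 * (r + 2) ≤ length I
            2q≤ = ≤-trans (*-monoʳ-≤ 2 large) 2X≤
            2≤2q : 2 ≤ 2 * (r + 2)
            2≤2q = ≤-trans (m≤n+m 2 r) (m≤m+n (r + 2) _)

          -- The 2m + 1 leaves would be isolated by at most m + (2m + 1) deletions outside `W`.
          isolating : (∀ {x y} → x ∈ leaves → y ∉ˢ W → adj G x y ≡ true → y ∈ Y) → ⊥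
          isolating nb = bound leaves Y (proj₁ leaves-Y) (λ x∈ → x∈) (proj₂ (proj₂ leaves-Y)) nb
            (≤-trans (n≤1+n _) (≤-reflexive (sym length-leaves)))
            (subst₂ _≤_ (cong (2 *_) (sym (length-++ X))) (cong (3 *_) (sym length-leaves))
              (no-single-count (length X) (length cores) (subst (length cores ≤_) (cong suc (length-pieces t)) (length-cores ps))))

          -- The removed edge has a deleted end, so restoring it gives no leaf a neighbour outside
          -- `Y`.
          deleted-end : ∀ {d} → Joins c d → c ∈ Y → ⊥
          deleted-end joins c∈Y = isolating nb
            where
            nb : ∀ {x y} → x ∈ leaves → y ∉ˢ W → adj G x y ≡ true → y ∈ Y
            nb x∈ y∉ xy with joins xy
            ... | inj₁ e                 = leaf-neighbour x∈ y∉ e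
            ... | inj₂ (inj₁ (refl , _)) = ⊥-elim (proj₂ (proj₂ leaves-Y) (x∈ , c∈Y))
            ... | inj₂ (inj₂ (_ , refl)) = c∈Y

          -- A single piece has an empty core, which pays for deleting c as well.
          single-end : ∀ {d} → Joins c d → c ≢ d → K1 d ∈ ps → ⊥
          single-end {d} joins c≢d d∈ with ∈⇒↭ d∈ | c ∈? leaves
          ... | qs , ps↭ | no c∉ = bound leaves (c ∷ Y) (proj₁ leaves-Y) (λ x∈ → x∈)
                  (λ { (x∈ , here refl) → c∉ x∈ ; (x∈ , there x∈Y) → proj₂ (proj₂ leaves-Y) (x∈ , x∈Y) }) nb
                  (≤-trans (n≤1+n _) (≤-reflexive (sym length-leaves)))
                  (subst₂ _≤_ (cong (λ k → 2 * suc k) (sym (length-++ X))) (cong (3 *_) (sym length-leaves))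
                    (one-single-count (length X) (length cores) cores≤))
            where
            nb : ∀ {x y} → x ∈ leaves → y ∉ˢ W → adj G x y ≡ true → y ∈ c ∷ Y
            nb x∈ y∉ xy with joins xy
            ... | inj₁ e                 = there (leaf-neighbour x∈ y∉ e)
            ... | inj₂ (inj₁ (refl , _)) = ⊥-elim (c∉ x∈)
            ... | inj₂ (inj₂ (_ , refl)) = here refl
            cores≤ : length cores ≤ 2 * length X
            cores≤ = subst₂ _≤_ (sym (length-cores-↭ ps↭))
              (suc-injective (trans (sym (↭-length ps↭)) (cong suc (length-pieces t)))) (length-cores qs)
          ... | qs , ps↭ | yes c∈ with ∈-resp-↭ ps↭ (leaf≡c⇒K1 c∈)
          ...   | here refl = c≢d refl
          ...   | there c∈qs with ∈⇒↭ c∈qs | ∈⇒↭ c∈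
          -- `c` moves from the isolated to the deleted vertices. Both `K1 c` and `K1 d` have empty
          -- cores, so at most 2m - 1 cores remain and the count still balances.
          ...     | qs′ , qs↭ | I , leaves↭ = bound I (c ∷ Y) (proj₁ (proj₂ I-unique)) I⊆
                  (λ { (x∈ , here refl) → proj₂ (proj₂ I-unique) (here refl , x∈)
                     ; (x∈ , there x∈Y) → proj₂ (proj₂ leaves-Y) (I⊆ x∈ , x∈Y) }) nb
                  (≤-reflexive (sym length-I))
                  (subst₂ _≤_ (cong (λ k → 2 * suc k) (sym (length-++ X))) (cong (3 *_) (sym length-I))
                    (two-singles-count (length X) (length cores) cores≤))
            where
            I⊆ : ∀ {x} → x ∈ I → x ∈ leaves
            I⊆ x∈ = ∈-resp-↭ (↭-sym leaves↭) (there x∈)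
            I-unique : Unique [ c ] × Unique I × Disjoint [ c ] I
            I-unique = unique-++⁻ [ c ] (unique-↭ leaves↭ (proj₁ leaves-Y))
            length-I : length I ≡ 2 * length X
            length-I = suc-injective (trans (sym (↭-length leaves↭)) length-leaves)
            nb : ∀ {x y} → x ∈ I → y ∉ˢ W → adj G x y ≡ true → y ∈ c ∷ Y
            nb x∈ y∉ xy with joins xy
            ... | inj₁ e                 = there (leaf-neighbour (I⊆ x∈) y∉ e)
            ... | inj₂ (inj₁ (refl , _)) = ⊥-elim (proj₂ (proj₂ I-unique) (here refl , x∈))
            ... | inj₂ (inj₂ (_ , refl)) = here refl
            ps↭′ : ps ↭ K1 d ∷ K1 c ∷ qs′
            ps↭′ = ↭-trans ps↭ (prep (K1 d) qs↭)
            cores≤ : 1 + length cores ≤ 2 * length X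
            cores≤ = subst₂ _≤_ (cong suc (sym (length-cores-↭ ps↭′)))
              (suc-injective (trans (sym (↭-length ps↭′)) (cong suc (length-pieces t)))) (s≤s (length-cores qs′))

      -- Orienting at an end of the removed edge deletes that end if it is a centre or lies in a
      -- pair; if an end is a single piece, the other end is deleted. If both ends lie outside the
      -- tree, the edge meets no leaf.
      large-contradiction : ¬ (r + 2 ≤ length X)
      large-contradiction large with u ∈? Oriented.Y u | v ∈? Oriented.Y v | u ∈? Oriented.leaves u | v ∈? Oriented.leaves v
      ... | yes u∈ | _ | _ | _ = Oriented.Large.deleted-end u large joins-uv u∈
      ... | no _ | yes v∈ | _ | _ = Oriented.Large.deleted-end v large joins-vu v∈
      ... | no _ | no _ | _ | yes v∈ = Oriented.Large.single-end u large joins-uv (adj-irrefl uv) (Oriented.leaf≡c⇒K1 v v∈)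
      ... | no _ | no _ | yes u∈ | no _ =
              Oriented.Large.single-end v large joins-vu (adj-irrefl uv ∘ sym) (Oriented.leaf≡c⇒K1 u u∈)
      ... | no _ | no v∉Y | no u∉ | no v∉ = Oriented.Large.isolating u large nb
        where
        open Oriented u
        v∉leaves : v ∉ leaves
        v∉leaves v∈ = [ v∉ , v∉Y ∘ ∈-++⁺ʳ X ]′
          (∈-++⁻ (Oriented.leaves v) (∈-resp-↭ (Oriented.split-↭ v ps) (leaf∈ps v∈)))
        nb : ∀ {x y} → x ∈ leaves → y ∉ˢ W → adj G x y ≡ true → y ∈ Y
        nb x∈ y∉ xy with joins-uv xy
        ... | inj₁ e                 = leaf-neighbour x∈ y∉ e
        ... | inj₂ (inj₁ (refl , _)) = ⊥-elim (u∉ x∈)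
        ... | inj₂ (inj₂ (refl , _)) = ⊥-elim (v∉leaves x∈)

    large-good : r + 2 ≤ length X → Good (whole t)
    large-good large with all-tame-or-good ps (λ Q∈ → Q∈)
    ... | inj₁ g    = g
    ... | inj₂ tame = ⊥-elim (Tamed.large-contradiction tame large)

    -- Trees with at most r + 1 centres, rooted away from `u` and `v`.

    module Small (small : length X ≤ r + 1) (avoids : Avoids B) {l} (l∈ : l ∈ vertsOf (pieces t)) where

      l∉B : l ∉ verts B
      l∉B l∈B = proj₂ (proj₂ (unique-++⁻ (verts B) unique-ps)) (l∈B , l∈)

      B⊆ps : ∀ {x} → x ∈ verts B → x ∈ vertsOf ps
      B⊆ps = ∈-ps (here refl)

      X∌B : ∀ {x} → x ∈ verts B → x ∉ X
      X∌B x∈B x∈X = disjoint-X-ps (x∈X , B⊆ps x∈B)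

      root-neighbour : ∀ {x y} → x ∈ verts B → adj G x y ≡ true → y ∉ˢ W → y ∈ X × E x y ⊎ y ∈ verts B ⊎ Out B x
      root-neighbour {x} {y} x∈ xy y∉ = [ (λ y∈X → inj₁ (y∈X , e)) , (λ y∈ → inj₂ (inner y∈)) ]′ (neighbour (B⊆ps x∈) y∉ e)
        where
        e : E x y
        e = avoiding-edge (λ { refl → proj₁ avoids x∈ }) (λ { refl → proj₂ avoids x∈ }) xy
        inner : y ∈ vertsOf ps → y ∈ verts B ⊎ Out B x
        inner y∈ with y ∈? verts B
        ... | yes y∈B = inj₁ y∈B
        ... | no y∉B  = inj₂ (lose y∈ (y∉B , e))

      -- Deleting `W` and the centres would cut the root piece off from `l`, which lies in another
      -- piece.
      not-separated : (∀ {x} → x ∈ verts B → ¬ Out B x) → ⊥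
      not-separated ¬out = l∉B (reaches conn X small (_∈ verts B) step′
          (ps∉W (B⊆ps b∈)) (X∌B b∈) b∈ (ps∉W (there-ps l∈)) (λ l∈X → disjoint-X-ps (l∈X , there-ps l∈)))
        where
        first : ∀ B → ∃ λ b → b ∈ verts B
        first (K1 x)     = x , here refl
        first (K2 x _ _) = x , here refl
        b∈ : proj₁ (first B) ∈ verts B
        b∈ = proj₂ (first B)
        there-ps : ∀ {x} → x ∈ vertsOf (pieces t) → x ∈ vertsOf ps
        there-ps = ∈-++⁺ʳ (verts B)
        step′ : ∀ {a b} → a ∈ verts B → adj G a b ≡ true → b ∉ˢ W → b ∉ X → b ∈ verts B
        step′ a∈ ab b∉W b∉X with root-neighbour a∈ ab b∉W
        ... | inj₁ (b∈X , _)   = ⊥-elim (b∉X b∈X)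
        ... | inj₂ (inj₁ b∈B)  = b∈B
        ... | inj₂ (inj₂ out)  = ⊥-elim (¬out a∈ out)

      module _ {p q} (B↭ : verts B ↭ p ∷ q ∷ []) (pq : E p q) (¬out : ¬ Out B p) where

        p∈B : p ∈ verts B
        p∈B = ∈-resp-↭ (↭-sym B↭) (here refl)

        q∈B : q ∈ verts B
        q∈B = ∈-resp-↭ (↭-sym B↭) (there (here refl))

        -- If `p` missed the centre `w`, its neighbours outside `W` would be among `q` and the other
        -- centres. Replacing `w` by `q` in the deleted set keeps its size and separates `p` from
        -- `w`.
        joined-to-X : ∀ {w} → w ∈ X → E p w
        joined-to-X {w} w∈ with E? p w | ∈⇒↭ w∈
        ... | yes e | _        = e
        ... | no ¬e | X′ , X↭ = ⊥-elim (X∌B p∈B (subst (_∈ X) w≡p w∈))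
          where
          X′⊆X : ∀ {x} → x ∈ X′ → x ∈ X
          X′⊆X x∈ = ∈-resp-↭ (↭-sym X↭) (there x∈)
          w∉X′ : w ∉ X′
          w∉X′ x∈ = proj₂ (proj₂ (unique-++⁻ [ w ] (unique-↭ X↭ (proj₁ (unique-++⁻ X unique-X-ps))))) (here refl , x∈)
          step′ : ∀ {a b} → a ≡ p → adj G a b ≡ true → b ∉ˢ W → b ∉ q ∷ X′ → b ≡ p
          step′ refl ab b∉W b∉D with root-neighbour p∈B ab b∉W
          ... | inj₂ (inj₂ out) = ⊥-elim (¬out out)
          ... | inj₂ (inj₁ b∈B) with ∈-resp-↭ B↭ b∈B
          ...   | here b≡p          = b≡p
          ...   | there (here refl) = ⊥-elim (b∉D (here refl))
          step′ refl ab b∉W b∉D | inj₁ (b∈X , e) with ∈-resp-↭ X↭ b∈X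
          ...   | here refl  = ⊥-elim (¬e e)
          ...   | there b∈X′ = ⊥-elim (b∉D (there b∈X′))
          w≡p : w ≡ p
          w≡p = reaches conn (q ∷ X′) (subst (_≤ r + 1) (↭-length X↭) small) (_≡ p) step′
            (ps∉W (B⊆ps p∈B))
            (λ { (here refl) → E-irrefl pq ; (there p∈) → X∌B p∈B (X′⊆X p∈) }) refl
            (X∉W w∈) (λ { (here refl) → X∌B q∈B w∈ ; (there w∈′) → w∉X′ w∈′ })

        pair-good : Good (whole t)
        pair-good with out? B q
        ... | yes out with out⇒piece t ≈-refl out
        ...   | T , y , T∈ , y∈ , e = pair-adjacent-through t B↭ pq joined-to-X T∈ y∈ e
        pair-good | no ¬outq = ⊥-elim (not-separated neither)
          where
          neither : ∀ {x} → x ∈ verts B → ¬ Out B x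
          neither x∈ with ∈-resp-↭ B↭ x∈
          ... | here refl         = ¬out
          ... | there (here refl) = ¬outq

      small-good : Good (whole t)
      small-good = go B refl (tame-or-good (here refl))
        where
        go : ∀ Q → B ≡ Q → Good (whole t) ⊎ Tame B → Good (whole t)
        go Q          _    (inj₁ g) = g
        go (K1 x)     refl (inj₂ τ) = ⊥-elim (not-separated λ { (here refl) → τ })
        go (K2 p q e) refl (inj₂ τ) with out? (K2 p q e) p
        ... | no ¬out = pair-good ↭-refl e ¬out
        ... | yes out = pair-good (swap p q ↭-refl) (E-sym e) (λ outq → τ (out , outq))

  -- Trees without centres.

  module Lonely {B} (rest : List (Fin N)) (perm : whole (leaf {B}) ++ rest ↭ σ)
                (closed : ∀ {x y} → x ∈ vertsOf (B ∷ []) → y ∈ rest → ¬ E x y) where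
    open Closed (leaf {B}) rest perm closed using (neighbour; ps∉W)

    root∈ : ∀ {x} → x ∈ verts B → x ∈ vertsOf (B ∷ [])
    root∈ = ∈-++⁺ˡ

    -- `D` holds at most one vertex: the partner of `x` in its pair, or the other end of the removed
    -- edge. Deleting it with `W` would isolate `x`, although a further vertex remains.
    not-alone : ∀ {x} D → x ∈ verts B → x ∉ D → length D ≤ 1 →
                (∀ {y} → adj G x y ≡ true → y ∉ D → E x y) → ¬ (∀ {y} → y ∈ verts B → y ∉ D → y ≡ x)
    not-alone {x} D x∈ x∉D D≤1 avoid only with fresh conn (x ∷ D) (≤-trans (s≤s D≤1) (m≤n+m 2 r))
    ... | z , z∉W , z∉ = z∉ (here (reaches conn D (≤-trans D≤1 (m≤n+m 1 r)) (_≡ x) step′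
        (ps∉W (root∈ x∈)) x∉D refl z∉W (z∉ ∘ there)))
      where
      step′ : ∀ {a b} → a ≡ x → adj G a b ≡ true → b ∉ˢ W → b ∉ D → b ≡ x
      step′ refl ab b∉W b∉D with neighbour (root∈ x∈) b∉W (avoid ab b∉D)
      ... | inj₂ b∈ with ∈-++⁻ (verts B) b∈
      ...   | inj₁ b∈B = only b∈B b∉D

    pair-end : ∀ {p q} → verts B ↭ p ∷ q ∷ [] → E p q → p ≢ u → p ≢ v → ⊥
    pair-end {p} {q} B↭ pq p≢u p≢v = not-alone (q ∷ []) (∈-resp-↭ (↭-sym B↭) (here refl))
      (λ { (here refl) → E-irrefl pq }) ≤-refl (λ py _ → avoiding-edge p≢u p≢v py) only
      where
      only : ∀ {y} → y ∈ verts B → y ∉ q ∷ [] → y ≡ p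
      only y∈ y∉ with ∈-resp-↭ B↭ y∈
      ... | here y≡p           = y≡p
      ... | there (here refl) = ⊥-elim (y∉ (here refl))

  -- A single root misses at most the edge to the other end. In a pair, some vertex is neither `u`
  -- nor `v`, because the pair is joined by an edge of `E`.
  lonely : ∀ {B} rest → whole (leaf {B}) ++ rest ↭ σ → (∀ {x y} → x ∈ vertsOf (B ∷ []) → y ∈ rest → ¬ E x y) → ⊥
  lonely {K1 x} rest perm closed with x ≟ u | x ≟ v
  ... | yes refl | _ = not-alone (v ∷ []) (here refl) (λ { (here refl) → adj-irrefl uv refl }) ≤-refl
          (λ xy y∉ → xy , (λ { (_ , refl) → y∉ (here refl) }) , (λ { (refl , _) → adj-irrefl uv refl }))
          (λ { (here refl) _ → refl })
    where open Lonely {K1 x} rest perm closed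
  ... | no x≢u | yes refl = not-alone (u ∷ []) (here refl) (λ { (here refl) → x≢u refl }) ≤-refl
          (λ xy y∉ → xy , (λ { (refl , _) → x≢u refl }) , (λ { (_ , refl) → y∉ (here refl) }))
          (λ { (here refl) _ → refl })
    where open Lonely {K1 x} rest perm closed
  ... | no x≢u | no x≢v = not-alone [] (here refl) (λ ()) z≤n (λ xy _ → avoiding-edge x≢u x≢v xy)
          (λ { (here refl) _ → refl })
    where open Lonely {K1 x} rest perm closed
  lonely {K2 p q e} rest perm closed with p ≟ u | p ≟ v
  ... | no p≢u | no p≢v = Lonely.pair-end {K2 p q e} rest perm closed ↭-refl e p≢u p≢v
  ... | yes refl | _ = Lonely.pair-end {K2 p q e} rest perm closed (swap p q ↭-refl) (E-sym e)
          (λ { refl → E-irrefl e }) (λ { refl → proj₁ (proj₂ e) (refl , refl) })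
  ... | no _ | yes refl = Lonely.pair-end {K2 p q e} rest perm closed (swap p q ↭-refl) (E-sym e)
          (λ { refl → proj₂ (proj₂ e) (refl , refl) }) (λ { refl → E-irrefl e })

  -- Choice of the root, and the resulting factor.

  one-avoids : ∀ P Q R → Disjoint (verts P) (verts Q) → Disjoint (verts P) (verts R) → Disjoint (verts Q) (verts R) →
               Avoids P ⊎ Avoids Q ⊎ Avoids R
  one-avoids P Q R PQ PR QR with avoids? P | avoids? Q | avoids? R
  ... | yes a | _     | _     = inj₁ a
  ... | no _  | yes a | _     = inj₂ (inj₁ a)
  ... | no _  | no _  | yes a = inj₂ (inj₂ a)
  ... | no a  | no b  | no c  = ⊥-elim (clash (meets P a) (meets Q b) (meets R c))
    where
    meets : ∀ P → ¬ Avoids P → u ∈ verts P ⊎ v ∈ verts P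
    meets P ¬a with u ∈? verts P | v ∈? verts P
    ... | yes u∈ | _      = inj₁ u∈
    ... | no _   | yes v∈ = inj₂ v∈
    ... | no u∉  | no v∉  = ⊥-elim (¬a (u∉ , v∉))
    clash : u ∈ verts P ⊎ v ∈ verts P → u ∈ verts Q ⊎ v ∈ verts Q → u ∈ verts R ⊎ v ∈ verts R → ⊥
    clash (inj₁ a) (inj₁ b) _        = PQ (a , b)
    clash (inj₂ a) (inj₂ b) _        = PQ (a , b)
    clash (inj₁ a) (inj₂ b) (inj₁ c) = PR (a , c)
    clash (inj₁ a) (inj₂ b) (inj₂ c) = QR (b , c)
    clash (inj₂ a) (inj₁ b) (inj₁ c) = QR (b , c)
    clash (inj₂ a) (inj₁ b) (inj₂ c) = PR (a , c)

  stuck : ∀ {B} (t : Tree B) rest → whole t ++ rest ↭ σ →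
          (∀ {x y} → x ∈ vertsOf (B ∷ pieces t) → y ∈ rest → ¬ E x y) → Good (whole t)
  stuck {B} t rest perm closed with (r + 2) ≤? length (centers t)
  ... | yes large = Closed.large-good t rest perm closed large
  ... | no ¬large = go t perm closed (s≤s⁻¹ (subst (suc (length (centers t)) ≤_) (+-suc r 1) (≰⇒> ¬large)))
    where
    at-root : ∀ {Q} (t : Tree Q) → whole t ++ rest ↭ σ → (∀ {x y} → x ∈ vertsOf (Q ∷ pieces t) → y ∈ rest → ¬ E x y) →
              length (centers t) ≤ r + 1 → Avoids Q → 1 ≤ length (centers t) → Good (whole t)
    -- A tree with a centre has a first branch, whose link to its left child supplies a vertex in
    -- another piece.
    at-root t@(branch w b l r′ tl tr t₀) perm closed small avoids 1≤ =
      Closed.Small.small-good t rest perm closed small avoids (∈-++⁺ˡ (Link.end∈ l))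
    go : ∀ {B} (t : Tree B) → whole t ++ rest ↭ σ → (∀ {x y} → x ∈ vertsOf (B ∷ pieces t) → y ∈ rest → ¬ E x y) →
         length (centers t) ≤ r + 1 → Good (whole t)
    go leaf perm closed small = ⊥-elim (lonely rest perm closed)
    -- The root and the two children of its first centre are three disjoint pieces, so one of them
    -- misses both `u` and `v` and becomes the new root.
    go {B} t@(branch w {L} {R} b l r′ tl tr t₀) perm closed small =
        [ at (here refl) , [ at (there (here refl)) , at (there (there (∈-++⁺ʳ (pieces tl) (here refl)))) ]′ ]′
          (one-avoids B L R (λ (x∈ , y∈) → dB (x∈ , ∈-++⁺ˡ y∈))
            (λ (x∈ , y∈) → dB (x∈ , ∈-++⁺ʳ (verts L) (∈R y∈))) (λ (x∈ , y∈) → dL (x∈ , ∈R y∈)))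
      where
      open Closed t rest perm closed using (unique-ps)
      dB : Disjoint (verts B) (vertsOf (pieces t))
      dB = proj₂ (proj₂ (unique-++⁻ (verts B) unique-ps))
      dL : Disjoint (verts L) (vertsOf (pieces tl ++ R ∷ pieces tr ++ pieces t₀))
      dL = proj₂ (proj₂ (unique-++⁻ (verts L) (proj₁ (proj₂ (unique-++⁻ (verts B) unique-ps)))))
      ∈R : ∀ {x} → x ∈ verts R → x ∈ vertsOf (pieces tl ++ R ∷ pieces tr ++ pieces t₀)
      ∈R x∈ = ∈-concatMap⁺ verts (lose (∈-++⁺ʳ (pieces tl) (here refl)) x∈)
      at : ∀ {Q} → Q ∈ B ∷ pieces t → Avoids Q → Good (whole t)
      at Q∈ avoids with reroot t Q∈
      ... | t′ , s@(same p c) = good-↭ (whole-≈ s) (at-root t′ (↭-trans (++⁺ʳ rest (whole-≈ s)) perm)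
              (λ x∈ → closed (∈-resp-↭ (concatMap-↭ verts p) x∈))
              (subst (_≤ r + 1) (sym (↭-length c)) small) avoids (subst (1 ≤_) (sym (↭-length c)) (s≤s z≤n)))

  factor : PathFactorAvoiding G 3 (∁ W) u v
  factor with Growth.good-all G E E-sym E? σ stuck
  ... | good paths long valid perm = record
    { paths = paths
    ; long  = long
    ; valid = valid
    ; disj  = unique-↭ (↭-sym perm) σ-unique
    ; cover = λ x → mk⇔ (λ x∈ → ∈-resp-↭ (↭-sym perm) (∈σ⁺ (x∈∁p⇒x∉p x∈))) (λ x∈ → x∉p⇒x∈∁p (∈σ⁻ (∈-resp-↭ perm x∈)))
    }

theorem8 : ∀ (n r N : ℕ) (G : Graph N) →
    KConnected G (n + r + 2) →
    IsolatedToughnessGt G (n + 3 * (r + 2)) (2 * (r + 2)) →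
    ∀ (W : Subset N) → ∣ W ∣ ≡ n →
    ∀ (u v : Fin N) → u ∉ˢ W → v ∉ˢ W → adj G u v ≡ true →
    PathFactorAvoiding G 3 (∁ W) u v
theorem8 n r N G conn tough W W≡n u v _ _ uv = StuckTree.factor n r N G conn tough W W≡n u v uv
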